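{- Let $X$ be a real normed linear space, let $a_1,\ldots,a_{n+1}$ be affinely independent elements of $X$, let $\Sigma=\mathsf{co}\{a_1,\ldots,a_{n+1}\}$ be the $n$-simplex with these vertices, and let $c$ be a relative interior point of $\Sigma$. Then there exists $\delta>0$ such that whenever $x_1,\ldots,x_{n+1}\in\mathsf{aff}(\Sigma)$ satisfy $\|x_k-a_k\|<\delta$ for each $k\le n+1$, the points $x_1,\ldots,x_{n+1}$ are affinely independent and $c$ is a relative interior point of the $n$-simplex $\mathsf{co}\{x_1,\ldots,x_{n+1}\}$.
   Context: The setting is Bishop's constructive mathematics (intuitionistic logic); "there exists" means the object can be constructed. In a normed space, $x\neq y$ means $\|x-y\|>0$. Vectors $v_1,\ldots,v_n$ are linearly independent if $\sum_i\lambda_iv_i\neq 0$ (i.e. $\|\sum_i\lambda_iv_i\|>0$) whenever $\sum_i|\lambda_i|>0$. Points $a_1,\ldots,a_{n+1}$ are affinely independent if $a_k-a_{n+1}$ ($1\le k\le n$) are linearly independent. $\mathsf{aff}(S)$ is the set of affine combinations $\sum\lambda_ks_k$ ($s_k\in S$, $\sum\lambda_k=1$) and $\mathsf{co}(S)$ the set of convex combinations (additionally $\lambda_k\ge0$). The convex hull of $n+1$ affinely independent points is an $n$-simplex with those vertices. $B_X(x,r)=\{y\in X:\|y-x\|<r\}$. The relative interior of $S\subset X$ is $\mathsf{relint}(S)=\{x\in S:\exists r>0\,(B_X(x,r)\cap\mathsf{aff}(S)\subset S)\}$; its elements are relative interior points. -}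

module Defs where

open import Algebra.Bundles using (CommutativeRing)
open import Algebra.Module.Bundles using (LeftModule)
import Algebra.Properties.Monoid.Sum as MonoidSum
open import Data.Fin.Base using (fromℕ; inject₁)
open import Data.Nat.Base as ℕ using (ℕ; suc)
import Data.Nat.Properties as ℕₚ
open import Data.Product.Base using (_×_; _,_; Σ-syntax; ∃-syntax)
open import Data.Rational.Base as ℚ using (ℚ; 0ℚ; 1ℚ; ½)
import Data.Rational.Properties as ℚₚ
open import Data.Rational.Solver using (module +-*-Solver)
open import Data.Sum.Base using (inj₁; inj₂)
open import Data.Vec.Functional using (Vector)
open import Level using (Level; 0ℓ; _⊔_) renaming (suc to lsuc)
open import Relation.Binary.Core using (Rel)
open import Relation.Binary.PropositionalEquality
  using (_≡_; refl; sym; trans; cong; subst)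
open import Relation.Binary.Structures using (IsEquivalence)
open import Relation.Unary using (Pred; _∈_; _∩_; _⊆_)

Eventually : (ℕ → Set) → Set
Eventually P = ∃[ N ] (∀ n → N ℕ.≤ n → P n)

-- Since Σ is strong, a proof of `IsCauchy u` contains a modulus of convergence.
IsCauchy : (ℕ → ℚ) → Set
IsCauchy u = ∀ ε → 0ℚ ℚ.< ε →
  ∃[ N ] (∀ m n → N ℕ.≤ m → N ℕ.≤ n → ℚ.∣ u m ℚ.- u n ∣ ℚ.< ε)

-- Bishop's regularity condition |u m - u n| ≤ 1/m + 1/n is relaxed to an
-- arbitrary modulus, so that all operations are pointwise.
record ℝ : Set where
  constructor real
  field
    seq    : ℕ → ℚ
    cauchy : IsCauchy seq

open ℝ public

infix 4 _≈_ _<_ _≤_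

-- The relations are records rather than synonyms so that x and y can be
-- inferred from the type of a proof.
record _≈_ (x y : ℝ) : Set where
  constructor mk≈
  field
    close : ∀ ε → 0ℚ ℚ.< ε → Eventually (λ n → ℚ.∣ seq x n ℚ.- seq y n ∣ ℚ.< ε)

record _<_ (x y : ℝ) : Set where
  constructor mk<
  field
    gap         : ℚ
    gap>0       : 0ℚ ℚ.< gap
    eventually< : Eventually (λ n → seq x n ℚ.+ gap ℚ.≤ seq y n)

record _≤_ (x y : ℝ) : Set where
  constructor mk≤
  field
    eventually≤ : ∀ ε → 0ℚ ℚ.< ε → Eventually (λ n → seq x n ℚ.≤ seq y n ℚ.+ ε)

open _≈_ public
open _<_ public
open _≤_ public

module Estimates where
  open +-*-Solver using (solve; _:+_; _:*_; _:-_; :-_; _:=_)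

  both : ∀ {P Q R : ℕ → Set} → (∀ n → P n → Q n → R n) →
         Eventually P → Eventually Q → Eventually R
  both f (M , p) (N , q) = M ℕ.⊔ N , λ n le →
    f n (p n (ℕₚ.≤-trans (ℕₚ.m≤m⊔n M N) le)) (q n (ℕₚ.≤-trans (ℕₚ.m≤n⊔m M N) le))

  half>0 : ∀ {ε} → 0ℚ ℚ.< ε → 0ℚ ℚ.< ½ ℚ.* ε
  half>0 {ε} p = subst (ℚ._< ½ ℚ.* ε) (ℚₚ.*-zeroʳ ½) (ℚₚ.*-monoʳ-<-pos ½ p)

  halves : ∀ ε → ½ ℚ.* ε ℚ.+ ½ ℚ.* ε ≡ ε
  halves ε = trans (sym (ℚₚ.*-distribʳ-+ ε ½ ½)) (ℚₚ.*-identityˡ ε)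

  +-close : ∀ a b a′ b′ {ε} → ℚ.∣ a ℚ.- a′ ∣ ℚ.< ½ ℚ.* ε → ℚ.∣ b ℚ.- b′ ∣ ℚ.< ½ ℚ.* ε →
            ℚ.∣ (a ℚ.+ b) ℚ.- (a′ ℚ.+ b′) ∣ ℚ.< ε
  +-close a b a′ b′ {ε} p q = begin-strict
    ℚ.∣ (a ℚ.+ b) ℚ.- (a′ ℚ.+ b′) ∣           ≡⟨ cong ℚ.∣_∣ (eq a b a′ b′) ⟩
    ℚ.∣ (a ℚ.- a′) ℚ.+ (b ℚ.- b′) ∣           ≤⟨ ℚₚ.∣p+q∣≤∣p∣+∣q∣ (a ℚ.- a′) (b ℚ.- b′) ⟩
    ℚ.∣ a ℚ.- a′ ∣ ℚ.+ ℚ.∣ b ℚ.- b′ ∣         <⟨ ℚₚ.+-mono-< p q ⟩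
    ½ ℚ.* ε ℚ.+ ½ ℚ.* ε                       ≡⟨ halves ε ⟩
    ε                                         ∎
    where
    open ℚₚ.≤-Reasoning
    eq : ∀ a b a′ b′ → (a ℚ.+ b) ℚ.- (a′ ℚ.+ b′) ≡ (a ℚ.- a′) ℚ.+ (b ℚ.- b′)
    eq = solve 4 (λ a b c d → (a :+ b) :- (c :+ d) := (a :- c) :+ (b :- d)) refl

  neg-dist : ∀ a b → ℚ.∣ (ℚ.- a) ℚ.- (ℚ.- b) ∣ ≡ ℚ.∣ a ℚ.- b ∣
  neg-dist a b = trans (cong ℚ.∣_∣ (eq a b)) (ℚₚ.∣-p∣≡∣p∣ (a ℚ.- b))
    where
    eq : ∀ a b → (ℚ.- a) ℚ.- (ℚ.- b) ≡ ℚ.- (a ℚ.- b)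
    eq = solve 2 (λ a b → (:- a) :- (:- b) := :- (a :- b)) refl

  dist-sym : ∀ a b → ℚ.∣ a ℚ.- b ∣ ≡ ℚ.∣ b ℚ.- a ∣
  dist-sym a b = trans (cong ℚ.∣_∣ (eq a b)) (ℚₚ.∣-p∣≡∣p∣ (b ℚ.- a))
    where
    eq : ∀ a b → a ℚ.- b ≡ ℚ.- (b ℚ.- a)
    eq = solve 2 (λ a b → a :- b := :- (b :- a)) refl

  dist-triangle : ∀ a b c → ℚ.∣ a ℚ.- c ∣ ℚ.≤ ℚ.∣ a ℚ.- b ∣ ℚ.+ ℚ.∣ b ℚ.- c ∣
  dist-triangle a b c = subst (ℚ._≤ ℚ.∣ a ℚ.- b ∣ ℚ.+ ℚ.∣ b ℚ.- c ∣) (cong ℚ.∣_∣ (eq a b c))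
    (ℚₚ.∣p+q∣≤∣p∣+∣q∣ (a ℚ.- b) (b ℚ.- c))
    where
    eq : ∀ a b c → (a ℚ.- b) ℚ.+ (b ℚ.- c) ≡ a ℚ.- c
    eq = solve 3 (λ a b c → (a :- b) :+ (b :- c) := a :- c) refl

  ≤-from-dist : ∀ a b {η} → ℚ.∣ a ℚ.- b ∣ ℚ.≤ η → ℚ.∣ a ∣ ℚ.≤ η ℚ.+ ℚ.∣ b ∣
  ≤-from-dist a b {η} p = begin
    ℚ.∣ a ∣                      ≡⟨ cong ℚ.∣_∣ (eq a b) ⟩
    ℚ.∣ (a ℚ.- b) ℚ.+ b ∣        ≤⟨ ℚₚ.∣p+q∣≤∣p∣+∣q∣ (a ℚ.- b) b ⟩
    ℚ.∣ a ℚ.- b ∣ ℚ.+ ℚ.∣ b ∣    ≤⟨ ℚₚ.+-monoˡ-≤ ℚ.∣ b ∣ p ⟩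
    η ℚ.+ ℚ.∣ b ∣                ∎
    where
    open ℚₚ.≤-Reasoning
    eq : ∀ a b → a ≡ (a ℚ.- b) ℚ.+ b
    eq = solve 2 (λ a b → a := (a :- b) :+ b) refl

  ∣∣-∣∣-≤ : ∀ a b → ℚ.∣ a ∣ ℚ.- ℚ.∣ b ∣ ℚ.≤ ℚ.∣ a ℚ.- b ∣
  ∣∣-∣∣-≤ a b = subst (ℚ.∣ a ∣ ℚ.- ℚ.∣ b ∣ ℚ.≤_) (eq ℚ.∣ a ℚ.- b ∣ ℚ.∣ b ∣)
    (ℚₚ.+-monoˡ-≤ (ℚ.- ℚ.∣ b ∣) (≤-from-dist a b ℚₚ.≤-refl))
    where
    eq : ∀ x y → (x ℚ.+ y) ℚ.- y ≡ x
    eq = solve 2 (λ x y → (x :+ y) :- y := x) refl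

  dist-∣∣ : ∀ a b → ℚ.∣ ℚ.∣ a ∣ ℚ.- ℚ.∣ b ∣ ∣ ℚ.≤ ℚ.∣ a ℚ.- b ∣
  dist-∣∣ a b with ℚₚ.∣p∣≡p∨∣p∣≡-p (ℚ.∣ a ∣ ℚ.- ℚ.∣ b ∣)
  ... | inj₁ e = subst (ℚ._≤ ℚ.∣ a ℚ.- b ∣) (sym e) (∣∣-∣∣-≤ a b)
  ... | inj₂ e = subst (ℚ._≤ ℚ.∣ a ℚ.- b ∣) (sym (trans e (eq ℚ.∣ a ∣ ℚ.∣ b ∣)))
    (subst (ℚ.∣ b ∣ ℚ.- ℚ.∣ a ∣ ℚ.≤_) (dist-sym b a) (∣∣-∣∣-≤ b a))
    where
    eq : ∀ x y → ℚ.- (x ℚ.- y) ≡ y ℚ.- x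
    eq = solve 2 (λ x y → :- (x :- y) := y :- x) refl

  eventually-bounded : ∀ x → ∃[ B ] (ℚ.Positive B × Eventually (λ n → ℚ.∣ seq x n ∣ ℚ.≤ B))
  eventually-bounded x with cauchy x 1ℚ (ℚₚ.positive⁻¹ 1ℚ)
  ... | N , near = 1ℚ ℚ.+ ℚ.∣ seq x N ∣
    , ℚ.positive (ℚₚ.+-mono-<-≤ (ℚₚ.positive⁻¹ 1ℚ) (ℚₚ.0≤∣p∣ (seq x N)))
    , N , λ n le → ≤-from-dist (seq x n) (seq x N) (ℚₚ.<⇒≤ (near n N le ℕₚ.≤-refl))

  divide : ∀ B .{{_ : ℚ.Positive B}} {ε} → 0ℚ ℚ.< ε → ∃[ η ] (0ℚ ℚ.< η × B ℚ.* η ≡ ε)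
  divide B {ε} ε>0 = 1/B ℚ.* ε , η>0 ,
    trans (sym (ℚₚ.*-assoc B 1/B ε)) (trans (cong (ℚ._* ε) (ℚₚ.*-inverseʳ B)) (ℚₚ.*-identityˡ ε))
    where
    instance _ = ℚₚ.pos⇒nonZero B
    1/B = ℚ.1/ B
    instance _ = ℚₚ.1/pos⇒pos B
    η>0 : 0ℚ ℚ.< 1/B ℚ.* ε
    η>0 = subst (ℚ._< 1/B ℚ.* ε) (ℚₚ.*-zeroʳ 1/B) (ℚₚ.*-monoʳ-<-pos 1/B ε>0)

  *-close : ∀ B .{{_ : ℚ.Positive B}} {ε η} → B ℚ.* η ≡ ½ ℚ.* ε → ∀ a b a′ b′ →
            ℚ.∣ a ∣ ℚ.≤ B → ℚ.∣ b′ ∣ ℚ.≤ B →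
            ℚ.∣ a ℚ.- a′ ∣ ℚ.< η → ℚ.∣ b ℚ.- b′ ∣ ℚ.< η →
            ℚ.∣ a ℚ.* b ℚ.- a′ ℚ.* b′ ∣ ℚ.< ε
  *-close B {ε} {η} Bη≡ a b a′ b′ a≤B b′≤B p q = begin-strict
    ℚ.∣ a ℚ.* b ℚ.- a′ ℚ.* b′ ∣
      ≡⟨ cong ℚ.∣_∣ (eq a b a′ b′) ⟩
    ℚ.∣ (b ℚ.- b′) ℚ.* a ℚ.+ (a ℚ.- a′) ℚ.* b′ ∣
      ≤⟨ ℚₚ.∣p+q∣≤∣p∣+∣q∣ ((b ℚ.- b′) ℚ.* a) ((a ℚ.- a′) ℚ.* b′) ⟩
    ℚ.∣ (b ℚ.- b′) ℚ.* a ∣ ℚ.+ ℚ.∣ (a ℚ.- a′) ℚ.* b′ ∣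
      <⟨ ℚₚ.+-mono-< (part (b ℚ.- b′) a q a≤B) (part (a ℚ.- a′) b′ p b′≤B) ⟩
    ½ ℚ.* ε ℚ.+ ½ ℚ.* ε
      ≡⟨ halves ε ⟩
    ε ∎
    where
    open ℚₚ.≤-Reasoning
    eq : ∀ a b a′ b′ →
         a ℚ.* b ℚ.- a′ ℚ.* b′ ≡ (b ℚ.- b′) ℚ.* a ℚ.+ (a ℚ.- a′) ℚ.* b′
    eq = solve 4 (λ a b c d → a :* b :- c :* d := (b :- d) :* a :+ (a :- c) :* d) refl
    part : ∀ u v → ℚ.∣ u ∣ ℚ.< η → ℚ.∣ v ∣ ℚ.≤ B → ℚ.∣ u ℚ.* v ∣ ℚ.< ½ ℚ.* ε
    part u v u<η v≤B = begin-strict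
      ℚ.∣ u ℚ.* v ∣           ≡⟨ ℚₚ.∣p*q∣≡∣p∣*∣q∣ u v ⟩
      ℚ.∣ u ∣ ℚ.* ℚ.∣ v ∣     ≤⟨ ℚₚ.*-monoˡ-≤-nonNeg ℚ.∣ u ∣ {{ℚₚ.∣-∣-nonNeg u}} v≤B ⟩
      ℚ.∣ u ∣ ℚ.* B           <⟨ ℚₚ.*-monoˡ-<-pos B u<η ⟩
      η ℚ.* B                 ≡⟨ ℚₚ.*-comm η B ⟩
      B ℚ.* η                 ≡⟨ Bη≡ ⟩
      ½ ℚ.* ε                 ∎

  common-bound : ∀ x y → ∃[ B ] (ℚ.Positive B ×
    Eventually (λ n → ℚ.∣ seq x n ∣ ℚ.≤ B × ℚ.∣ seq y n ∣ ℚ.≤ B))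
  common-bound x y = combine (eventually-bounded x) (eventually-bounded y)
    where
    combine : ∃[ B ] (ℚ.Positive B × Eventually (λ n → ℚ.∣ seq x n ∣ ℚ.≤ B)) →
              ∃[ B ] (ℚ.Positive B × Eventually (λ n → ℚ.∣ seq y n ∣ ℚ.≤ B)) →
              ∃[ B ] (ℚ.Positive B ×
                Eventually (λ n → ℚ.∣ seq x n ∣ ℚ.≤ B × ℚ.∣ seq y n ∣ ℚ.≤ B))
    combine (B , B>0 , p) (C , C>0 , q) = D , D>0 , both bound p q
      where
      D = B ℚ.⊔ C
      B≤D = ℚₚ.p≤p⊔q B C
      C≤D = ℚₚ.p≤q⊔p B C
      D>0 : ℚ.Positive D
      D>0 = ℚ.positive {D} (ℚₚ.<-≤-trans (ℚₚ.positive⁻¹ B {{B>0}}) B≤D)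
      bound : ∀ n → ℚ.∣ seq x n ∣ ℚ.≤ B → ℚ.∣ seq y n ∣ ℚ.≤ C →
              ℚ.∣ seq x n ∣ ℚ.≤ D × ℚ.∣ seq y n ∣ ℚ.≤ D
      bound n u v = ℚₚ.≤-trans u B≤D , ℚₚ.≤-trans v C≤D

open Estimates

infixl 6 _+_
infixl 7 _*_
infix  8 -_

private
  -- Keeps conversion checking from unfolding the proofs inside real numbers.
  abstract
    +-cauchy : ∀ x y → IsCauchy (λ n → seq x n ℚ.+ seq y n)
    +-cauchy x y ε ε>0 =
      let M , p = cauchy x (½ ℚ.* ε) (half>0 ε>0)
          N , q = cauchy y (½ ℚ.* ε) (half>0 ε>0)
      in M ℕ.⊔ N , λ m n m≥ n≥ → +-close (seq x m) (seq y m) (seq x n) (seq y n)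
           (p m n (ℕₚ.m⊔n≤o⇒m≤o M N m≥) (ℕₚ.m⊔n≤o⇒m≤o M N n≥))
           (q m n (ℕₚ.m⊔n≤o⇒n≤o M N m≥) (ℕₚ.m⊔n≤o⇒n≤o M N n≥))

    -‿cauchy : ∀ x → IsCauchy (λ n → ℚ.- seq x n)
    -‿cauchy x ε ε>0 =
      let N , p = cauchy x ε ε>0
      in N , λ m n m≥ n≥ → subst (ℚ._< ε) (sym (neg-dist (seq x m) (seq x n))) (p m n m≥ n≥)

    ∣∣-cauchy : ∀ x → IsCauchy (λ n → ℚ.∣ seq x n ∣)
    ∣∣-cauchy x ε ε>0 =
      let N , p = cauchy x ε ε>0
      in N , λ m n m≥ n≥ → ℚₚ.≤-<-trans (dist-∣∣ (seq x m) (seq x n)) (p m n m≥ n≥)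

    *-cauchy : ∀ x y → IsCauchy (λ n → seq x n ℚ.* seq y n)
    *-cauchy x y ε ε>0 =
      let B , B>0 , K , bound = common-bound x y
          instance _ = B>0
          η , η>0 , Bη≡ = divide B (half>0 ε>0)
          M , p = cauchy x η η>0
          N , q = cauchy y η η>0
      in K ℕ.⊔ (M ℕ.⊔ N) , λ m n m≥ n≥ →
           let m≥′ = ℕₚ.m⊔n≤o⇒n≤o K (M ℕ.⊔ N) m≥
               n≥′ = ℕₚ.m⊔n≤o⇒n≤o K (M ℕ.⊔ N) n≥
               xm≤B , _ = bound m (ℕₚ.m⊔n≤o⇒m≤o K (M ℕ.⊔ N) m≥)
               _ , yn≤B = bound n (ℕₚ.m⊔n≤o⇒m≤o K (M ℕ.⊔ N) n≥)
           in *-close B Bη≡ (seq x m) (seq y m) (seq x n) (seq y n) xm≤B yn≤B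
                (p m n (ℕₚ.m⊔n≤o⇒m≤o M N m≥′) (ℕₚ.m⊔n≤o⇒m≤o M N n≥′))
                (q m n (ℕₚ.m⊔n≤o⇒n≤o M N m≥′) (ℕₚ.m⊔n≤o⇒n≤o M N n≥′))

    const-cauchy : ∀ q → IsCauchy (λ _ → q)
    const-cauchy q ε ε>0 = 0 , λ _ _ _ _ →
      subst (ℚ._< ε) (sym (cong ℚ.∣_∣ (ℚₚ.+-inverseʳ q))) ε>0

_+_ : ℝ → ℝ → ℝ
x + y = real (λ n → seq x n ℚ.+ seq y n) (+-cauchy x y)

-_ : ℝ → ℝ
- x = real (λ n → ℚ.- seq x n) (-‿cauchy x)

∣_∣ : ℝ → ℝ
∣ x ∣ = real (λ n → ℚ.∣ seq x n ∣) (∣∣-cauchy x)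

_*_ : ℝ → ℝ → ℝ
x * y = real (λ n → seq x n ℚ.* seq y n) (*-cauchy x y)

fromℚ : ℚ → ℝ
fromℚ q = real (λ _ → q) (const-cauchy q)

0ℝ 1ℝ : ℝ
0ℝ = fromℚ 0ℚ
1ℝ = fromℚ 1ℚ

pointwise : ∀ {x y} → (∀ n → seq x n ≡ seq y n) → x ≈ y
pointwise {x} {y} x≡y = mk≈ λ ε ε>0 → 0 , λ n _ → subst (ℚ._< ε)
  (sym (cong ℚ.∣_∣ (trans (cong (ℚ._- seq y n) (x≡y n)) (ℚₚ.+-inverseʳ (seq y n))))) ε>0

≈-isEquivalence : IsEquivalence _≈_
≈-isEquivalence = record
  { refl  = pointwise (λ _ → refl)
  ; sym   = λ {x} {y} x≈y → mk≈ λ ε ε>0 → let N , p = close x≈y ε ε>0 in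
      N , λ n n≥ → subst (ℚ._< ε) (dist-sym (seq x n) (seq y n)) (p n n≥)
  ; trans = λ {x} {y} {z} x≈y y≈z → mk≈ λ ε ε>0 →
      both (λ n p q → ℚₚ.≤-<-trans (dist-triangle (seq x n) (seq y n) (seq z n))
                        (subst (_ ℚ.<_) (halves ε) (ℚₚ.+-mono-< p q)))
           (close x≈y _ (half>0 ε>0)) (close y≈z _ (half>0 ε>0))
  }

+-cong : ∀ {x y u v} → x ≈ y → u ≈ v → x + u ≈ y + v
+-cong {x} {y} {u} {v} x≈y u≈v = mk≈ λ ε ε>0 →
  both (λ n → +-close (seq x n) (seq u n) (seq y n) (seq v n))
       (close x≈y _ (half>0 ε>0)) (close u≈v _ (half>0 ε>0))

-‿cong : ∀ {x y} → x ≈ y → - x ≈ - y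
-‿cong {x} {y} x≈y = mk≈ λ ε ε>0 → let N , p = close x≈y ε ε>0 in
  N , λ n n≥ → subst (ℚ._< ε) (sym (neg-dist (seq x n) (seq y n))) (p n n≥)

*-cong : ∀ {x y u v} → x ≈ y → u ≈ v → x * u ≈ y * v
*-cong {x} {y} {u} {v} x≈y u≈v = mk≈ λ ε ε>0 →
  let B , B>0 , bound = common-bound x v
      instance _ = B>0
      η , η>0 , Bη≡ = divide B (half>0 ε>0)
  in both (λ { n (x≤B , v≤B) (p , q) →
                 *-close B Bη≡ (seq x n) (seq u n) (seq y n) (seq v n) x≤B v≤B p q })
          bound (both (λ _ → _,_) (close x≈y η η>0) (close u≈v η η>0))

ℝ-commutativeRing : CommutativeRing 0ℓ 0ℓ
ℝ-commutativeRing = record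
  { Carrier = ℝ ; _≈_ = _≈_ ; _+_ = _+_ ; _*_ = _*_ ; -_ = -_ ; 0# = 0ℝ ; 1# = 1ℝ
  ; isCommutativeRing = record
    { isRing = record
      { +-isAbelianGroup = record
        { isGroup = record
          { isMonoid = record
            { isSemigroup = record
              { isMagma = record
                { isEquivalence = ≈-isEquivalence
                ; ∙-cong = +-cong }
              ; assoc = λ x y z → pointwise λ n →
                  ℚₚ.+-assoc (seq x n) (seq y n) (seq z n) }
            ; identity = (λ x → pointwise λ n → ℚₚ.+-identityˡ (seq x n))
                       , (λ x → pointwise λ n → ℚₚ.+-identityʳ (seq x n)) }
          ; inverse = (λ x → pointwise λ n → ℚₚ.+-inverseˡ (seq x n))
                    , (λ x → pointwise λ n → ℚₚ.+-inverseʳ (seq x n))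
          ; ⁻¹-cong = -‿cong }
        ; comm = λ x y → pointwise λ n → ℚₚ.+-comm (seq x n) (seq y n) }
      ; *-cong = *-cong
      ; *-assoc = λ x y z → pointwise λ n →
          ℚₚ.*-assoc (seq x n) (seq y n) (seq z n)
      ; *-identity = (λ x → pointwise λ n → ℚₚ.*-identityˡ (seq x n))
                   , (λ x → pointwise λ n → ℚₚ.*-identityʳ (seq x n))
      ; distrib = (λ x y z → pointwise λ n →
                     ℚₚ.*-distribˡ-+ (seq x n) (seq y n) (seq z n))
                , (λ x y z → pointwise λ n →
                     ℚₚ.*-distribʳ-+ (seq x n) (seq y n) (seq z n)) }
    ; *-comm = λ x y → pointwise λ n → ℚₚ.*-comm (seq x n) (seq y n) } }

open CommutativeRing ℝ-commutativeRing public using () renaming (ring to ℝ-ring)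

open MonoidSum (CommutativeRing.+-monoid ℝ-commutativeRing) public
  using () renaming (sum to sumℝ)

record NormedSpace (v ℓ : Level) : Set (lsuc (v ⊔ ℓ)) where
  field
    leftModule : LeftModule ℝ-ring v ℓ

  open LeftModule leftModule public

  infixl 6 _-ᴹ_

  _-ᴹ_ : Carrierᴹ → Carrierᴹ → Carrierᴹ
  x -ᴹ y = x +ᴹ (-ᴹ y)

  field
    ‖_‖          : Carrierᴹ → ℝ
    ‖‖-cong      : ∀ {x y} → x ≈ᴹ y → ‖ x ‖ ≈ ‖ y ‖
    ‖‖-nonNeg    : ∀ x → 0ℝ ≤ ‖ x ‖
    ‖‖-definite  : ∀ x → ‖ x ‖ ≈ 0ℝ → x ≈ᴹ 0ᴹ
    ‖‖-homo      : ∀ t x → ‖ t *ₗ x ‖ ≈ ∣ t ∣ * ‖ x ‖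
    ‖‖-triangle  : ∀ x y → ‖ x +ᴹ y ‖ ≤ ‖ x ‖ + ‖ y ‖

  open MonoidSum +ᴹ-monoid public using () renaming (sum to sumᴹ)

module Geometry {v ℓ} (X : NormedSpace v ℓ) where
  open NormedSpace X public

  combination : ∀ {n} → Vector ℝ n → Vector Carrierᴹ n → Carrierᴹ
  combination t x = sumᴹ (λ i → t i *ₗ x i)

  infix 4 _≠_

  _≠_ : Rel Carrierᴹ 0ℓ
  x ≠ y = 0ℝ < ‖ x -ᴹ y ‖

  LinearlyIndependent : ∀ {n} → Vector Carrierᴹ n → Set
  LinearlyIndependent x = ∀ t → 0ℝ < sumℝ (λ i → ∣ t i ∣) → combination t x ≠ 0ᴹ

  AffinelyIndependent : ∀ {n} → Vector Carrierᴹ (suc n) → Set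
  AffinelyIndependent {n} a = LinearlyIndependent λ k → a (inject₁ k) -ᴹ a (fromℕ n)

  points : ∀ {n} → Vector Carrierᴹ n → Pred Carrierᴹ ℓ
  points a x = ∃[ k ] x ≈ᴹ a k

  aff : ∀ {s} → Pred Carrierᴹ s → Pred Carrierᴹ (v ⊔ ℓ ⊔ s)
  aff S x = ∃[ m ] Σ[ t ∈ Vector ℝ m ] Σ[ p ∈ Vector Carrierᴹ m ]
    (∀ k → p k ∈ S) × sumℝ t ≈ 1ℝ × x ≈ᴹ combination t p

  co : ∀ {s} → Pred Carrierᴹ s → Pred Carrierᴹ (v ⊔ ℓ ⊔ s)
  co S x = ∃[ m ] Σ[ t ∈ Vector ℝ m ] Σ[ p ∈ Vector Carrierᴹ m ]
    (∀ k → p k ∈ S) × sumℝ t ≈ 1ℝ × (∀ k → 0ℝ ≤ t k) × x ≈ᴹ combination t p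

  Ball : Carrierᴹ → ℝ → Pred Carrierᴹ 0ℓ
  Ball x r y = ‖ y -ᴹ x ‖ < r

  relint : ∀ {s} → Pred Carrierᴹ s → Pred Carrierᴹ (v ⊔ ℓ ⊔ s)
  relint S x = x ∈ S × ∃[ r ] (0ℝ < r × Ball x r ∩ aff S ⊆ S)

{-# OPTIONS --safe #-}
module Submission where

-- Being a relative interior point already makes the vertices quantitatively
-- independent: if every displacement of c of norm at most g stays in the simplex,
-- then rescaling a direction Σ τₖ aₖ (with Σ τₖ = 0) to norm g moves the barycentric
-- coordinates of c by at most 1, whence g |τₖ| ≤ ‖Σ τₖ aₖ‖.  Likewise, moving c away
-- from aₖ shows that its coordinates are at least some ρ > 0.
--
-- For x near a, write x = (1 + E) a in barycentric coordinates, where E has small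
-- row sums of absolute values.  Combinations transform by t ↦ t (1 + E), a map that
-- is bounded below in the ℓ₁ norm, so x is affinely independent with a similar lower
-- bound.  It is also onto (by elimination), so c has coordinates κ with respect to x,
-- and these are close to the old ones, hence bounded away from 0.

open import Defs
open Estimates using (both; half>0; halves; dist-∣∣; divide; eventually-bounded)
open import Algebra.Bundles using (CommutativeRing)
import Algebra.Properties.AbelianGroup as AbelianGroupProperties
import Algebra.Properties.CommutativeMonoid.Sum as CommutativeMonoidSum
import Algebra.Properties.Semiring.Sum as SemiringSum
import Algebra.Solver.Ring as RingSolver
open import Algebra.Solver.Ring.AlmostCommutativeRing
  using (fromCommutativeRing; _-Raw-AlmostCommutative⟶_)
open import Data.Fin.Base using (Fin; zero; suc; inject₁; fromℕ)
open import Data.Maybe.Base using (Maybe; just; nothing)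
open import Data.Nat.Base as ℕ using (ℕ; suc; zero)
import Data.Nat.Properties as ℕₚ
open import Data.Product.Base using (_×_; _,_; proj₁; proj₂; ∃-syntax; Σ-syntax)
open import Data.Rational.Base as ℚ using (ℚ; 0ℚ; 1ℚ; ½)
import Data.Rational.Properties as ℚₚ
import Data.Rational.Solver as ℚ-Solver
open import Data.Sum.Base using (inj₁; inj₂)
open import Data.Vec.Functional using (Vector)
open import Function.Base using (_∘_)
open import Level using (0ℓ)
open import Relation.Binary.Bundles using (Poset)
open import Relation.Binary.PropositionalEquality as ≡ using (_≡_)
import Relation.Binary.Reasoning.PartialOrder as PartialOrderReasoning
import Relation.Binary.Reasoning.Setoid as SetoidReasoning
open import Relation.Nullary using (¬_; yes; no; contradiction)
open import Relation.Unary using (_∈_)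

module R = CommutativeRing ℝ-commutativeRing

open CommutativeMonoidSum R.+-commutativeMonoid
  using (∑-distrib-+; ∑-comm; sum-cong-≋; sum-init-last)
open SemiringSum R.semiring using (*-distribˡ-sum; *-distribʳ-sum)

-- Rational arithmetic.

2ℚ : ℚ
2ℚ = 1ℚ ℚ.+ 1ℚ

module _ where
  open ℚ-Solver.+-*-Solver

  p+q-q≡p : ∀ p q → p ℚ.+ q ℚ.- q ≡ p
  p+q-q≡p = solve 2 (λ p q → p :+ q :- q := p) ≡.refl

  p+[q-p]≡q : ∀ p q → p ℚ.+ (q ℚ.- p) ≡ q
  p+[q-p]≡q = solve 2 (λ p q → p :+ (q :- p) := q) ≡.refl

  p+q-p≡q : ∀ p q → p ℚ.+ q ℚ.- p ≡ q
  p+q-p≡q = solve 2 (λ p q → p :+ q :- p := q) ≡.refl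

  q-p≡-[p-q] : ∀ p q → q ℚ.- p ≡ ℚ.- (p ℚ.- q)
  q-p≡-[p-q] = solve 2 (λ p q → q :- p := :- (p :- q)) ≡.refl

  [p+h]+[q+h]≡[p+q]+h+h : ∀ p q h → (p ℚ.+ h) ℚ.+ (q ℚ.+ h) ≡ p ℚ.+ q ℚ.+ h ℚ.+ h
  [p+h]+[q+h]≡[p+q]+h+h = solve 3 (λ p q h → (p :+ h) :+ (q :+ h) := p :+ q :+ h :+ h) ≡.refl

  pq[i-j]≡[pi]q-[qj]p : ∀ p q i j → p ℚ.* q ℚ.* (i ℚ.- j) ≡ (p ℚ.* i) ℚ.* q ℚ.- (q ℚ.* j) ℚ.* p
  pq[i-j]≡[pi]q-[qj]p = solve 4 (λ p q i j → p :* q :* (i :- j) := (p :* i) :* q :- (q :* j) :* p) ≡.refl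

  2*2*½*½*p≡p : ∀ p → 2ℚ ℚ.* (2ℚ ℚ.* (½ ℚ.* (½ ℚ.* p))) ≡ p
  2*2*½*½*p≡p = solve 1 (λ p → con 2ℚ :* (con 2ℚ :* (con ½ :* (con ½ :* p))) := p) ≡.refl

+-halves : ∀ p ε → p ℚ.+ ½ ℚ.* ε ℚ.+ ½ ℚ.* ε ≡ p ℚ.+ ε
+-halves p ε = ≡.trans (ℚₚ.+-assoc p (½ ℚ.* ε) (½ ℚ.* ε)) (≡.cong (p ℚ.+_) (halves ε))

p≤q+r⇒p-q≤r : ∀ p q {r} → p ℚ.≤ q ℚ.+ r → p ℚ.- q ℚ.≤ r
p≤q+r⇒p-q≤r p q {r} h = ≡.subst (p ℚ.- q ℚ.≤_) (p+q-p≡q q r) (ℚₚ.+-monoˡ-≤ (ℚ.- q) h)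

p-q≤r⇒p≤q+r : ∀ p q {r} → p ℚ.- q ℚ.≤ r → p ℚ.≤ q ℚ.+ r
p-q≤r⇒p≤q+r p q {r} h = ≡.subst (ℚ._≤ q ℚ.+ r) (p+[q-p]≡q q p) (ℚₚ.+-monoʳ-≤ q h)

*-pos-ℚ : ∀ {p q} → 0ℚ ℚ.< p → 0ℚ ℚ.< q → 0ℚ ℚ.< p ℚ.* q
*-pos-ℚ {p} {q} p>0 q>0 = ℚₚ.positive⁻¹ _ {{ℚₚ.pos*pos⇒pos p {{ℚ.positive p>0}} q {{ℚ.positive q>0}}}}

⊓-pos-ℚ : ∀ {p q} → 0ℚ ℚ.< p → 0ℚ ℚ.< q → 0ℚ ℚ.< p ℚ.⊓ q
⊓-pos-ℚ {p} {q} p>0 q>0 with ℚₚ.⊓-sel p q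
... | inj₁ e = ≡.subst (0ℚ ℚ.<_) (≡.sym e) p>0
... | inj₂ e = ≡.subst (0ℚ ℚ.<_) (≡.sym e) q>0

p≤∣p∣ : ∀ p → p ℚ.≤ ℚ.∣ p ∣
p≤∣p∣ p with ℚₚ.≤-total 0ℚ p
... | inj₁ 0≤p = ℚₚ.≤-reflexive (≡.sym (ℚₚ.0≤p⇒∣p∣≡p 0≤p))
... | inj₂ p≤0 = ℚₚ.≤-trans p≤0 (ℚₚ.0≤∣p∣ p)

∣p∣≤q : ∀ {p q} → p ℚ.≤ q → ℚ.- p ℚ.≤ q → ℚ.∣ p ∣ ℚ.≤ q
∣p∣≤q {p} p≤q -p≤q with ℚₚ.∣p∣≡p∨∣p∣≡-p p
... | inj₁ e = ≡.subst (ℚ._≤ _) (≡.sym e) p≤q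
... | inj₂ e = ≡.subst (ℚ._≤ _) (≡.sym e) -p≤q

∣p-q∣≤r⇒p≤q+r : ∀ p q {r} → ℚ.∣ p ℚ.- q ∣ ℚ.≤ r → p ℚ.≤ q ℚ.+ r
∣p-q∣≤r⇒p≤q+r p q h = p-q≤r⇒p≤q+r p q (ℚₚ.≤-trans (p≤∣p∣ (p ℚ.- q)) h)

half<self : ∀ {ε} → 0ℚ ℚ.< ε → ½ ℚ.* ε ℚ.< ε
half<self {ε} ε>0 = ≡.subst₂ ℚ._<_ (ℚₚ.+-identityʳ (½ ℚ.* ε)) (halves ε)
  (ℚₚ.+-monoʳ-< (½ ℚ.* ε) (half>0 ε>0))

-- Ring identities between real numbers.

module ℝ-Solver where
  private
    -- Equality of reals is undecidable, so the solver takes its coefficients from ℚ, where it can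
    -- be decided, and embeds them by `fromℚ`.
    constants : CommutativeRing.rawRing ℚₚ.+-*-commutativeRing
                -Raw-AlmostCommutative⟶ fromCommutativeRing ℝ-commutativeRing
    constants = record
      { ⟦_⟧ = fromℚ
      ; +-homo = λ _ _ → pointwise λ _ → ≡.refl
      ; *-homo = λ _ _ → pointwise λ _ → ≡.refl
      ; -‿homo = λ _ → pointwise λ _ → ≡.refl
      ; 0-homo = R.refl
      ; 1-homo = R.refl
      }

    same? : ∀ p q → Maybe (fromℚ p ≈ fromℚ q)
    same? p q with p ℚₚ.≟ q
    ... | yes ≡.refl = just R.refl
    ... | no _       = nothing

  open RingSolver (CommutativeRing.rawRing ℚₚ.+-*-commutativeRing)
    (fromCommutativeRing ℝ-commutativeRing) constants same? public
    using (solve; con; _:+_; _:*_; _:-_; :-_; _:=_)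

open ℝ-Solver

-- Order on the real numbers

pointwise-≤ : ∀ {x y} → (∀ n → seq x n ℚ.≤ seq y n) → x ≤ y
pointwise-≤ {x} {y} x≤y = mk≤ λ ε ε>0 → 0 , λ n _ →
  ≡.subst (ℚ._≤ seq y n ℚ.+ ε) (ℚₚ.+-identityʳ (seq x n)) (ℚₚ.+-mono-≤ (x≤y n) (ℚₚ.<⇒≤ ε>0))

≤-reflexive : ∀ {x y} → x ≈ y → x ≤ y
≤-reflexive {x} {y} x≈y = mk≤ λ ε ε>0 → let N , p = close x≈y ε ε>0 in
  N , λ n n≥ → ∣p-q∣≤r⇒p≤q+r (seq x n) (seq y n) (ℚₚ.<⇒≤ (p n n≥))

≤-trans : ∀ {x y z} → x ≤ y → y ≤ z → x ≤ z
≤-trans {x} {y} {z} x≤y y≤z = mk≤ λ ε ε>0 →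
  both (λ n p q → ℚₚ.≤-trans p (≡.subst (_ ℚ.≤_) (+-halves (seq z n) ε) (ℚₚ.+-monoˡ-≤ (½ ℚ.* ε) q)))
       (eventually≤ x≤y _ (half>0 ε>0)) (eventually≤ y≤z _ (half>0 ε>0))

≤-antisym : ∀ {x y} → x ≤ y → y ≤ x → x ≈ y
≤-antisym {x} {y} x≤y y≤x = mk≈ λ ε ε>0 →
  both (λ n p q → ℚₚ.≤-<-trans
          (∣p∣≤q (p≤q+r⇒p-q≤r (seq x n) (seq y n) p)
                 (≡.subst (ℚ._≤ ½ ℚ.* ε) (q-p≡-[p-q] (seq x n) (seq y n)) (p≤q+r⇒p-q≤r (seq y n) (seq x n) q)))
          (half<self ε>0))
       (eventually≤ x≤y _ (half>0 ε>0)) (eventually≤ y≤x _ (half>0 ε>0))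

≤-refl : ∀ {x} → x ≤ x
≤-refl = ≤-reflexive R.refl

≤-poset : Poset 0ℓ 0ℓ 0ℓ
≤-poset = record
  { isPartialOrder = record
    { isPreorder = record
      { isEquivalence = ≈-isEquivalence
      ; reflexive = ≤-reflexive
      ; trans = ≤-trans }
    ; antisym = ≤-antisym } }

module ≤-Reasoning = PartialOrderReasoning ≤-poset

+-mono-≤ : ∀ {x y u v} → x ≤ y → u ≤ v → x + u ≤ y + v
+-mono-≤ {x} {y} {u} {v} x≤y u≤v = mk≤ λ ε ε>0 →
  both (λ n p q → ≡.subst (seq x n ℚ.+ seq u n ℚ.≤_)
          (≡.trans ([p+h]+[q+h]≡[p+q]+h+h (seq y n) (seq v n) (½ ℚ.* ε)) (+-halves (seq y n ℚ.+ seq v n) ε))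
          (ℚₚ.+-mono-≤ p q))
       (eventually≤ x≤y _ (half>0 ε>0)) (eventually≤ u≤v _ (half>0 ε>0))

+-monoˡ-≤ : ∀ z {x y} → x ≤ y → x + z ≤ y + z
+-monoˡ-≤ z h = +-mono-≤ h ≤-refl

+-monoʳ-≤ : ∀ z {x y} → x ≤ y → z + x ≤ z + y
+-monoʳ-≤ z h = +-mono-≤ ≤-refl h

x≤y⇒0≤y-x : ∀ {x y} → x ≤ y → 0ℝ ≤ y R.- x
x≤y⇒0≤y-x {x} x≤y = ≤-trans (≤-reflexive (R.sym (R.-‿inverseʳ x))) (+-monoˡ-≤ (- x) x≤y)

0≤y-x⇒x≤y : ∀ {x y} → 0ℝ ≤ y R.- x → x ≤ y
0≤y-x⇒x≤y {x} {y} h = begin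
  x             ≈⟨ R.+-identityˡ x ⟨
  0ℝ + x        ≤⟨ +-monoˡ-≤ x h ⟩
  y R.- x + x   ≈⟨ solve 2 (λ x y → y :- x :+ x := y) R.refl x y ⟩
  y             ∎
  where open ≤-Reasoning

≤-from-≤+ε : ∀ {x y} → (∀ ε → 0ℚ ℚ.< ε → x ≤ y + fromℚ ε) → x ≤ y
≤-from-≤+ε {x} {y} h = mk≤ λ ε ε>0 →
  let N , p = eventually≤ (h (½ ℚ.* ε) (half>0 ε>0)) (½ ℚ.* ε) (half>0 ε>0) in
  N , λ n n≥ → ≡.subst (seq x n ℚ.≤_) (+-halves (seq y n) ε) (p n n≥)

fromℚ-mono-≤ : ∀ {p q} → p ℚ.≤ q → fromℚ p ≤ fromℚ q
fromℚ-mono-≤ p≤q = pointwise-≤ λ _ → p≤q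

fromℚ-pos : ∀ {q} → 0ℚ ℚ.< q → 0ℝ < fromℚ q
fromℚ-pos {q} q>0 = mk< q q>0 (0 , λ _ _ → ℚₚ.≤-reflexive (ℚₚ.+-identityˡ q))

fromℚ-nonNeg : ∀ {q} → 0ℚ ℚ.< q → 0ℝ ≤ fromℚ q
fromℚ-nonNeg q>0 = fromℚ-mono-≤ (ℚₚ.<⇒≤ q>0)

<⇒≤ : ∀ {x y} → x < y → x ≤ y
<⇒≤ {x} {y} (mk< g g>0 (N , x+g≤y)) = mk≤ λ ε ε>0 → N , λ n n≥ → begin
  seq x n            ≡⟨ ℚₚ.+-identityʳ (seq x n) ⟨
  seq x n ℚ.+ 0ℚ     ≤⟨ ℚₚ.+-monoʳ-≤ (seq x n) (ℚₚ.<⇒≤ g>0) ⟩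
  seq x n ℚ.+ g      ≤⟨ x+g≤y n n≥ ⟩
  seq y n            ≡⟨ ℚₚ.+-identityʳ (seq y n) ⟨
  seq y n ℚ.+ 0ℚ     ≤⟨ ℚₚ.+-monoʳ-≤ (seq y n) (ℚₚ.<⇒≤ ε>0) ⟩
  seq y n ℚ.+ ε      ∎
  where open ℚₚ.≤-Reasoning

-- The relation `≤` holds termwise only up to an arbitrary error. Half of the gap pays for that
-- error, and the other half is the gap that remains.
<-≤-trans : ∀ {x y z} → x < y → y ≤ z → x < z
<-≤-trans {x} {y} {z} (mk< g g>0 x<y) y≤z = mk< h (half>0 g>0)
  (both (λ n → step (seq x n) (seq y n) (seq z n)) x<y (eventually≤ y≤z h (half>0 g>0)))
  where
  h = ½ ℚ.* g
  open ℚₚ.≤-Reasoning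
  step : ∀ p q r → p ℚ.+ g ℚ.≤ q → q ℚ.≤ r ℚ.+ h → p ℚ.+ h ℚ.≤ r
  step p q r p+g≤q q≤r+h = begin
    p ℚ.+ h                ≡⟨ p+q-q≡p (p ℚ.+ h) h ⟨
    p ℚ.+ h ℚ.+ h ℚ.- h    ≡⟨ ≡.cong (ℚ._- h) (+-halves p g) ⟩
    p ℚ.+ g ℚ.- h          ≤⟨ ℚₚ.+-monoˡ-≤ (ℚ.- h) (ℚₚ.≤-trans p+g≤q q≤r+h) ⟩
    r ℚ.+ h ℚ.- h          ≡⟨ p+q-q≡p r h ⟩
    r                      ∎

≤-<-trans : ∀ {x y z} → x ≤ y → y < z → x < z
≤-<-trans {x} {y} {z} x≤y (mk< g g>0 y<z) = mk< h (half>0 g>0)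
  (both (λ n → step (seq x n) (seq y n) (seq z n)) (eventually≤ x≤y h (half>0 g>0)) y<z)
  where
  h = ½ ℚ.* g
  open ℚₚ.≤-Reasoning
  step : ∀ p q r → p ℚ.≤ q ℚ.+ h → q ℚ.+ g ℚ.≤ r → p ℚ.+ h ℚ.≤ r
  step p q r p≤q+h q+g≤r = begin
    p ℚ.+ h            ≤⟨ ℚₚ.+-monoˡ-≤ h p≤q+h ⟩
    q ℚ.+ h ℚ.+ h      ≡⟨ +-halves q g ⟩
    q ℚ.+ g            ≤⟨ q+g≤r ⟩
    r                  ∎

x≮x : ∀ {x} → ¬ (x < x)
x≮x {x} (mk< g g>0 (N , h)) = ℚₚ.<-irrefl (ℚₚ.+-identityʳ (seq x N))
  (ℚₚ.<-≤-trans (ℚₚ.+-monoʳ-< (seq x N) g>0) (h N ℕₚ.≤-refl))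

half-below : ∀ {q x} → 0ℚ ℚ.< q → fromℚ q ≤ x → fromℚ (½ ℚ.* q) < x
half-below {q} q>0 q≤x = <-≤-trans
  (mk< (½ ℚ.* q) (half>0 q>0) (0 , λ _ _ → ℚₚ.≤-reflexive (halves q))) q≤x

-- Trades a positive real for a positive rational, by which `divide` can then divide exactly.
positive⇒rational-lower-bound : ∀ {x} → 0ℝ < x → ∃[ q ] (0ℚ ℚ.< q × fromℚ q ≤ x)
positive⇒rational-lower-bound {x} (mk< g g>0 (N , 0+g≤)) = g , g>0 , mk≤ λ ε ε>0 → N , λ n n≥ → begin
  g                  ≡⟨ ℚₚ.+-identityˡ g ⟨
  0ℚ ℚ.+ g           ≤⟨ 0+g≤ n n≥ ⟩
  seq x n            ≡⟨ ℚₚ.+-identityʳ (seq x n) ⟨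
  seq x n ℚ.+ 0ℚ     ≤⟨ ℚₚ.+-monoʳ-≤ (seq x n) (ℚₚ.<⇒≤ ε>0) ⟩
  seq x n ℚ.+ ε      ∎
  where open ℚₚ.≤-Reasoning

rational-upper-bound : ∀ x → ∃[ B ] (0ℚ ℚ.< B × x ≤ fromℚ B)
rational-upper-bound x = bound (eventually-bounded x)
  where
  open ℚₚ.≤-Reasoning
  bound : ∃[ B ] (ℚ.Positive B × Eventually (λ n → ℚ.∣ seq x n ∣ ℚ.≤ B)) →
          ∃[ B ] (0ℚ ℚ.< B × x ≤ fromℚ B)
  bound (B , B>0 , N , ∣x∣≤B) = B , ℚₚ.positive⁻¹ B {{B>0}} , mk≤ λ ε ε>0 → N , λ n n≥ → begin
    seq x n            ≤⟨ p≤∣p∣ (seq x n) ⟩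
    ℚ.∣ seq x n ∣      ≤⟨ ∣x∣≤B n n≥ ⟩
    B                  ≡⟨ ℚₚ.+-identityʳ B ⟨
    B ℚ.+ 0ℚ           ≤⟨ ℚₚ.+-monoʳ-≤ B (ℚₚ.<⇒≤ ε>0) ⟩
    B ℚ.+ ε            ∎

-- No excluded middle is involved: at precision `ε/4`, the rational `seq x N` is decidably either at
-- most `ε/2`, which keeps the tail below `ε`, or larger, which would leave `x` a gap of `ε/4` above
-- 0.
≯0⇒≤0 : ∀ {x} → ¬ (0ℝ < x) → x ≤ 0ℝ
≯0⇒≤0 {x} x≯0 = mk≤ bound
  where
  bound : ∀ ε → 0ℚ ℚ.< ε → Eventually (λ n → seq x n ℚ.≤ 0ℚ ℚ.+ ε)
  bound ε ε>0 with cauchy x (½ ℚ.* (½ ℚ.* ε)) (half>0 (half>0 ε>0))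
  ... | N , near with seq x N ℚₚ.≤? ½ ℚ.* ε
  ... | yes xN≤ = N , λ n n≥ → begin
      seq x n                               ≤⟨ ∣p-q∣≤r⇒p≤q+r (seq x n) (seq x N) (ℚₚ.<⇒≤ (near n N n≥ ℕₚ.≤-refl)) ⟩
      seq x N ℚ.+ ½ ℚ.* (½ ℚ.* ε)           ≤⟨ ℚₚ.+-mono-≤ xN≤ (ℚₚ.<⇒≤ (half<self (half>0 ε>0))) ⟩
      ½ ℚ.* ε ℚ.+ ½ ℚ.* ε                   ≡⟨ halves ε ⟩
      ε                                     ≡⟨ ℚₚ.+-identityˡ ε ⟨
      0ℚ ℚ.+ ε                              ∎
      where open ℚₚ.≤-Reasoning
  ... | no xN≰ = contradiction (mk< q (half>0 (half>0 ε>0)) (N , λ n n≥ → begin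
      0ℚ ℚ.+ q                  ≡⟨ ℚₚ.+-identityˡ q ⟩
      q                         ≡⟨ p+q-q≡p q q ⟨
      q ℚ.+ q ℚ.- q             ≡⟨ ≡.cong (ℚ._- q) (halves (½ ℚ.* ε)) ⟩
      ½ ℚ.* ε ℚ.- q             ≤⟨ ℚₚ.+-monoˡ-≤ (ℚ.- q) (ℚₚ.<⇒≤ (ℚₚ.≰⇒> xN≰)) ⟩
      seq x N ℚ.- q             ≤⟨ ℚₚ.+-monoˡ-≤ (ℚ.- q) (∣p-q∣≤r⇒p≤q+r (seq x N) (seq x n) (ℚₚ.<⇒≤ (near N n ℕₚ.≤-refl n≥))) ⟩
      seq x n ℚ.+ q ℚ.- q       ≡⟨ p+q-q≡p (seq x n) q ⟩
      seq x n                   ∎)) x≯0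
      where
      q = ½ ℚ.* (½ ℚ.* ε)
      open ℚₚ.≤-Reasoning

-- Absolute values, products and reciprocals.

∣∣-cong : ∀ {x y} → x ≈ y → ∣ x ∣ ≈ ∣ y ∣
∣∣-cong {x} {y} x≈y = mk≈ λ ε ε>0 → let N , p = close x≈y ε ε>0 in
  N , λ n n≥ → ℚₚ.≤-<-trans (dist-∣∣ (seq x n) (seq y n)) (p n n≥)

0≤∣x∣ : ∀ x → 0ℝ ≤ ∣ x ∣
0≤∣x∣ x = pointwise-≤ λ n → ℚₚ.0≤∣p∣ (seq x n)

x≤∣x∣ : ∀ x → x ≤ ∣ x ∣
x≤∣x∣ x = pointwise-≤ λ n → p≤∣p∣ (seq x n)

∣-x∣≈∣x∣ : ∀ x → ∣ - x ∣ ≈ ∣ x ∣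
∣-x∣≈∣x∣ x = pointwise λ n → ℚₚ.∣-p∣≡∣p∣ (seq x n)

-x≤∣x∣ : ∀ x → - x ≤ ∣ x ∣
-x≤∣x∣ x = ≤-trans (x≤∣x∣ (- x)) (≤-reflexive (∣-x∣≈∣x∣ x))

∣x+y∣≤∣x∣+∣y∣ : ∀ x y → ∣ x + y ∣ ≤ ∣ x ∣ + ∣ y ∣
∣x+y∣≤∣x∣+∣y∣ x y = pointwise-≤ λ n → ℚₚ.∣p+q∣≤∣p∣+∣q∣ (seq x n) (seq y n)

∣x*y∣≈∣x∣*∣y∣ : ∀ x y → ∣ x * y ∣ ≈ ∣ x ∣ * ∣ y ∣
∣x*y∣≈∣x∣*∣y∣ x y = pointwise λ n → ℚₚ.∣p*q∣≡∣p∣*∣q∣ (seq x n) (seq y n)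

∣x∣≤y : ∀ {x y} → x ≤ y → - x ≤ y → ∣ x ∣ ≤ y
∣x∣≤y x≤y -x≤y = mk≤ λ ε ε>0 →
  both (λ _ → ∣p∣≤q) (eventually≤ x≤y ε ε>0) (eventually≤ -x≤y ε ε>0)

neg-antimono-≤ : ∀ {x y} → x ≤ y → - y ≤ - x
neg-antimono-≤ {x} {y} x≤y = 0≤y-x⇒x≤y (≤-trans (x≤y⇒0≤y-x x≤y)
  (≤-reflexive (solve 2 (λ x y → y :- x := :- x :- :- y) R.refl x y)))

0≤x⇒∣x∣≈x : ∀ {x} → 0ℝ ≤ x → ∣ x ∣ ≈ x
0≤x⇒∣x∣≈x {x} 0≤x = ≤-antisym (∣x∣≤y ≤-refl -x≤x) (x≤∣x∣ x)
  where
  open ≤-Reasoning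
  -x≤x : - x ≤ x
  -x≤x = begin
    - x   ≤⟨ neg-antimono-≤ 0≤x ⟩
    - 0ℝ  ≈⟨ pointwise (λ _ → ≡.refl) ⟩
    0ℝ    ≤⟨ 0≤x ⟩
    x     ∎

-- A nonnegative real may have negative terms, so no termwise argument applies to `x * y` itself;
-- its absolute value does have nonnegative terms.
*-nonNeg : ∀ {x y} → 0ℝ ≤ x → 0ℝ ≤ y → 0ℝ ≤ x * y
*-nonNeg {x} {y} 0≤x 0≤y = begin
  0ℝ             ≤⟨ 0≤∣x∣ (x * y) ⟩
  ∣ x * y ∣      ≈⟨ ∣x*y∣≈∣x∣*∣y∣ x y ⟩
  ∣ x ∣ * ∣ y ∣  ≈⟨ R.*-cong (0≤x⇒∣x∣≈x 0≤x) (0≤x⇒∣x∣≈x 0≤y) ⟩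
  x * y          ∎
  where open ≤-Reasoning

*-monoʳ-≤ : ∀ {z x y} → 0ℝ ≤ z → x ≤ y → z * x ≤ z * y
*-monoʳ-≤ {z} {x} {y} 0≤z x≤y = 0≤y-x⇒x≤y (≤-trans (*-nonNeg 0≤z (x≤y⇒0≤y-x x≤y))
  (≤-reflexive (solve 3 (λ x y z → z :* (y :- x) := z :* y :- z :* x) R.refl x y z)))

*-monoˡ-≤ : ∀ {z x y} → 0ℝ ≤ z → x ≤ y → x * z ≤ y * z
*-monoˡ-≤ {z} {x} {y} 0≤z x≤y = begin
  x * z  ≈⟨ R.*-comm x z ⟩
  z * x  ≤⟨ *-monoʳ-≤ 0≤z x≤y ⟩
  z * y  ≈⟨ R.*-comm z y ⟩
  y * z  ∎
  where open ≤-Reasoning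

*-cancelˡ-≤ : ∀ {q} → 0ℚ ℚ.< q → ∀ {x y} → fromℚ q * x ≤ fromℚ q * y → x ≤ y
*-cancelˡ-≤ {q} q>0 {x} {y} h with divide q {{ℚ.positive q>0}} (ℚₚ.positive⁻¹ 1ℚ)
... | i , i>0 , qi≡1 = begin
  x                         ≈⟨ cancel x ⟨
  fromℚ i * (fromℚ q * x)   ≤⟨ *-monoʳ-≤ (fromℚ-nonNeg i>0) h ⟩
  fromℚ i * (fromℚ q * y)   ≈⟨ cancel y ⟩
  y                         ∎
  where
  open ≤-Reasoning
  cancel : ∀ z → fromℚ i * (fromℚ q * z) ≈ z
  cancel z = R.trans (R.sym (R.*-assoc _ _ z)) (R.trans
    (R.*-congʳ (pointwise λ _ → ≡.trans (ℚₚ.*-comm i q) qi≡1)) (R.*-identityˡ z))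

-- Inversion needs a known distance from 0, which `q` supplies: from index `N` on, the terms are at
-- least `h = q/2`. Earlier terms may vanish, so `u` replaces them by the term at `N`.
1/_ : ∀ {x} → ∃[ q ] (0ℚ ℚ.< q × fromℚ q ≤ x) → ∃[ y ] (0ℝ ≤ y × x * y ≈ 1ℝ)
1/_ {x} (q , q>0 , q≤x) = real inv inv-cauchy , pointwise-≤ inv-nonNeg , mk≈ λ ε ε>0 → N , λ n n≥ →
    ≡.subst (ℚ._< ε) (≡.sym (≡.cong ℚ.∣_∣ (≡.trans (≡.cong (ℚ._- 1ℚ) (inv-inverse n n≥)) (ℚₚ.+-inverseʳ 1ℚ)))) ε>0
  where
  h = ½ ℚ.* q
  h>0 = half>0 q>0
  N = proj₁ (eventually≤ q≤x h h>0)
  q≤xₙ+h = proj₂ (eventually≤ q≤x h h>0)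
  u : ℕ → ℚ
  u n = seq x (N ℕ.⊔ n)
  h≤u : ∀ n → h ℚ.≤ u n
  h≤u n = begin
    h                  ≡⟨ p+q-q≡p h h ⟨
    h ℚ.+ h ℚ.- h      ≡⟨ ≡.cong (ℚ._- h) (halves q) ⟩
    q ℚ.- h            ≤⟨ ℚₚ.+-monoˡ-≤ (ℚ.- h) (q≤xₙ+h (N ℕ.⊔ n) (ℕₚ.m≤m⊔n N n)) ⟩
    u n ℚ.+ h ℚ.- h    ≡⟨ p+q-q≡p (u n) h ⟩
    u n                ∎
    where open ℚₚ.≤-Reasoning
  instance
    h-pos : ℚ.Positive h
    h-pos = ℚ.positive h>0
    u-pos : ∀ {n} → ℚ.Positive (u n)
    u-pos {n} = ℚ.positive (ℚₚ.<-≤-trans h>0 (h≤u n))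
    u≢0 : ∀ {n} → ℚ.NonZero (u n)
    u≢0 {n} = ℚₚ.pos⇒nonZero (u n)
  inv : ℕ → ℚ
  inv n = ℚ.1/ u n
  inv-pos : ∀ n → ℚ.Positive (inv n)
  inv-pos n = ℚₚ.1/pos⇒pos (u n)
  inv-nonNeg : ∀ n → 0ℚ ℚ.≤ inv n
  inv-nonNeg n = ℚₚ.<⇒≤ (ℚₚ.positive⁻¹ (inv n) {{inv-pos n}})
  inv-inverse : ∀ n → N ℕ.≤ n → seq x n ℚ.* inv n ≡ 1ℚ
  inv-inverse n n≥ = ≡.trans (≡.cong (λ k → seq x k ℚ.* inv n) (≡.sym (ℕₚ.m≤n⇒m⊔n≡n n≥))) (ℚₚ.*-inverseʳ (u n))
  -- 1/v − 1/w = (w − v) / (v w), and both denominators stay above h.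
  h²∣inv-inv∣≤ : ∀ m n → h ℚ.* h ℚ.* ℚ.∣ inv m ℚ.- inv n ∣ ℚ.≤ ℚ.∣ u n ℚ.- u m ∣
  h²∣inv-inv∣≤ m n = begin
    h ℚ.* h ℚ.* d                   ≤⟨ ℚₚ.*-monoʳ-≤-nonNeg d {{ℚₚ.∣-∣-nonNeg (inv m ℚ.- inv n)}} hh≤uu ⟩
    u m ℚ.* u n ℚ.* d               ≡⟨ ≡.cong (ℚ._* d) (ℚₚ.0≤p⇒∣p∣≡p uu≥0) ⟨
    ℚ.∣ u m ℚ.* u n ∣ ℚ.* d         ≡⟨ ℚₚ.∣p*q∣≡∣p∣*∣q∣ (u m ℚ.* u n) (inv m ℚ.- inv n) ⟨
    ℚ.∣ u m ℚ.* u n ℚ.* (inv m ℚ.- inv n) ∣  ≡⟨ ≡.cong ℚ.∣_∣ clear ⟩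
    ℚ.∣ u n ℚ.- u m ∣               ∎
    where
    open ℚₚ.≤-Reasoning
    d = ℚ.∣ inv m ℚ.- inv n ∣
    hh≤uu : h ℚ.* h ℚ.≤ u m ℚ.* u n
    hh≤uu = ℚₚ.≤-trans (ℚₚ.*-monoʳ-≤-nonNeg h {{ℚₚ.pos⇒nonNeg h}} (h≤u m))
                       (ℚₚ.*-monoˡ-≤-nonNeg (u m) {{ℚₚ.pos⇒nonNeg (u m)}} (h≤u n))
    uu≥0 : 0ℚ ℚ.≤ u m ℚ.* u n
    uu≥0 = ℚₚ.<⇒≤ (*-pos-ℚ (ℚₚ.positive⁻¹ (u m)) (ℚₚ.positive⁻¹ (u n)))
    clear : u m ℚ.* u n ℚ.* (inv m ℚ.- inv n) ≡ u n ℚ.- u m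
    clear = ≡.trans (pq[i-j]≡[pi]q-[qj]p (u m) (u n) (inv m) (inv n)) (≡.cong₂ ℚ._-_
      (≡.trans (≡.cong (ℚ._* u n) (ℚₚ.*-inverseʳ (u m))) (ℚₚ.*-identityˡ (u n)))
      (≡.trans (≡.cong (ℚ._* u m) (ℚₚ.*-inverseʳ (u n))) (ℚₚ.*-identityˡ (u m))))
  inv-cauchy : IsCauchy inv
  inv-cauchy ε ε>0 =
    -- The precision `h² ε` makes up for the factor `h²` in `h²∣inv-inv∣≤`.
    let M , near = cauchy x (h ℚ.* h ℚ.* ε) (*-pos-ℚ h²>0 ε>0)
    in M , λ m n m≥ n≥ → ℚₚ.*-cancelˡ-<-nonNeg (h ℚ.* h) {{ℚₚ.pos⇒nonNeg (h ℚ.* h) {{ℚ.positive h²>0}}}}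
      (ℚₚ.≤-<-trans (h²∣inv-inv∣≤ m n)
        (near (N ℕ.⊔ n) (N ℕ.⊔ m) (ℕₚ.≤-trans n≥ (ℕₚ.m≤n⊔m N n)) (ℕₚ.≤-trans m≥ (ℕₚ.m≤n⊔m N m))))
    where
    h²>0 = *-pos-ℚ h>0 h>0

-- Linear systems close to the identity

2ℝ : ℝ
2ℝ = fromℚ 2ℚ

0≤2 : 0ℝ ≤ 2ℝ
0≤2 = fromℚ-mono-≤ (ℚₚ.nonNegative⁻¹ 2ℚ)

-- Finite sums.

sum-mono-≤ : ∀ {n} {f g : Vector ℝ n} → (∀ i → f i ≤ g i) → sumℝ f ≤ sumℝ g
sum-mono-≤ {zero}  f≤g = ≤-refl
sum-mono-≤ {suc n} f≤g = +-mono-≤ (f≤g zero) (sum-mono-≤ (f≤g ∘ suc))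

sum-nonNeg : ∀ {n} {f : Vector ℝ n} → (∀ i → 0ℝ ≤ f i) → 0ℝ ≤ sumℝ f
sum-nonNeg {zero}  0≤f = ≤-refl
sum-nonNeg {suc n} 0≤f = ≤-trans (≤-reflexive (R.sym (R.+-identityˡ 0ℝ)))
  (+-mono-≤ (0≤f zero) (sum-nonNeg (0≤f ∘ suc)))

term≤sum : ∀ {n} {f : Vector ℝ n} → (∀ i → 0ℝ ≤ f i) → ∀ i → f i ≤ sumℝ f
term≤sum {f = f} 0≤f zero = ≤-trans (≤-reflexive (R.sym (R.+-identityʳ (f zero))))
  (+-monoʳ-≤ (f zero) (sum-nonNeg (0≤f ∘ suc)))
term≤sum {f = f} 0≤f (suc i) = ≤-trans (≤-reflexive (R.sym (R.+-identityˡ (f (suc i)))))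
  (+-mono-≤ (0≤f zero) (term≤sum (0≤f ∘ suc) i))

∣sum∣≤sum∣∣ : ∀ {n} (f : Vector ℝ n) → ∣ sumℝ f ∣ ≤ sumℝ (λ i → ∣ f i ∣)
∣sum∣≤sum∣∣ {zero}  f = pointwise-≤ λ _ → ℚₚ.≤-refl
∣sum∣≤sum∣∣ {suc n} f = ≤-trans (∣x+y∣≤∣x∣+∣y∣ (f zero) (sumℝ (f ∘ suc)))
  (+-monoʳ-≤ ∣ f zero ∣ (∣sum∣≤sum∣∣ (f ∘ suc)))

-- The embedding of ℕ in ℚ, by a recursion that runs in step with `sumℝ`.
natural : ℕ → ℚ
natural zero    = 0ℚ
natural (suc n) = 1ℚ ℚ.+ natural n

natural-nonNeg : ∀ n → 0ℚ ℚ.≤ natural n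
natural-nonNeg zero    = ℚₚ.≤-refl
natural-nonNeg (suc n) = ℚₚ.+-mono-≤ (ℚₚ.nonNegative⁻¹ 1ℚ) (natural-nonNeg n)

natural-pos : ∀ n → 0ℚ ℚ.< natural (suc n)
natural-pos n = ℚₚ.+-mono-<-≤ (ℚₚ.positive⁻¹ 1ℚ) (natural-nonNeg n)

sum-const : ∀ n x → sumℝ {n} (λ _ → x) ≈ fromℚ (natural n) * x
sum-const zero    x = R.sym (R.zeroˡ x)
sum-const (suc n) x = begin-equality
  x + sumℝ {n} (λ _ → x)               ≈⟨ R.+-congˡ (sum-const n x) ⟩
  x + fromℚ (natural n) * x            ≈⟨ R.+-congʳ (R.*-identityˡ x) ⟨
  1ℝ * x + fromℚ (natural n) * x       ≈⟨ R.distribʳ x 1ℝ (fromℚ (natural n)) ⟨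
  (1ℝ + fromℚ (natural n)) * x         ≈⟨ R.*-congʳ (pointwise λ _ → ≡.refl) ⟩
  fromℚ (natural (suc n)) * x          ∎
  where open ≤-Reasoning

-- Matrices acting on row vectors, and the ℓ₁ norm.

Matrix : ℕ → ℕ → Set
Matrix m n = Vector (Vector ℝ n) m

∥_∥₁ : ∀ {n} → Vector ℝ n → ℝ
∥ v ∥₁ = sumℝ (λ i → ∣ v i ∣)

infixl 7 _·_
_·_ : ∀ {m n} → Vector ℝ m → Matrix m n → Vector ℝ n
(v · E) j = sumℝ (λ k → v k * E k j)

∣v∣≤∥v∥₁ : ∀ {n} (v : Vector ℝ n) i → ∣ v i ∣ ≤ ∥ v ∥₁
∣v∣≤∥v∥₁ v = term≤sum (λ i → 0≤∣x∣ (v i))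

sum-· : ∀ {m n} (v : Vector ℝ m) (E : Matrix m n) → sumℝ (v · E) ≈ sumℝ (λ k → v k * sumℝ (E k))
sum-· v E = R.trans (R.sym (∑-comm (λ k j → v k * E k j)))
  (sum-cong-≋ (λ k → R.sym (*-distribˡ-sum (v k) (E k))))

-- For row vectors with the ℓ₁ norm, the operator norm is governed by the absolute row sums: apply
-- the triangle inequality and exchange the two summations.
∥v·E∥₁≤ : ∀ {m n θ} (v : Vector ℝ m) (E : Matrix m n) → (∀ k → ∥ E k ∥₁ ≤ θ) →
          ∥ v · E ∥₁ ≤ ∥ v ∥₁ * θ
∥v·E∥₁≤ {θ = θ} v E rows = begin
  ∥ v · E ∥₁
    ≤⟨ sum-mono-≤ (λ j → ∣sum∣≤sum∣∣ (λ k → v k * E k j)) ⟩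
  sumℝ (λ j → sumℝ (λ k → ∣ v k * E k j ∣))
    ≈⟨ sum-cong-≋ (λ j → sum-cong-≋ (λ k → ∣x*y∣≈∣x∣*∣y∣ (v k) (E k j))) ⟩
  sumℝ ((λ k → ∣ v k ∣) · (λ k j → ∣ E k j ∣))
    ≈⟨ sum-· (λ k → ∣ v k ∣) (λ k j → ∣ E k j ∣) ⟩
  sumℝ (λ k → ∣ v k ∣ * ∥ E k ∥₁)
    ≤⟨ sum-mono-≤ (λ k → *-monoʳ-≤ (0≤∣x∣ (v k)) (rows k)) ⟩
  sumℝ (λ k → ∣ v k ∣ * θ)
    ≈⟨ *-distribʳ-sum θ (λ k → ∣ v k ∣) ⟨
  ∥ v ∥₁ * θ ∎
  where open ≤-Reasoning

x+y≈z⇒x≈z-y : ∀ {x y z} → x + y ≈ z → x ≈ z R.- y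
x+y≈z⇒x≈z-y {x} {y} {z} h = R.trans (solve 2 (λ x y → x := x :+ y :- y) R.refl x y) (R.+-congʳ h)

∣z-y∣≤∣z∣+∣y∣ : ∀ z y → ∣ z R.- y ∣ ≤ ∣ z ∣ + ∣ y ∣
∣z-y∣≤∣z∣+∣y∣ z y = ≤-trans (∣x+y∣≤∣x∣+∣y∣ z (- y)) (+-monoʳ-≤ ∣ z ∣ (≤-reflexive (∣-x∣≈∣x∣ y)))

-- Since `v = u − vE` and `E` at least halves the norm, `∥v∥ ≤ ∥u∥ + ½∥v∥`, where the last term can
-- be absorbed on the left.
∥v∥₁≤2∥v+vE∥₁ : ∀ {n} (v u : Vector ℝ n) (E : Matrix n n) → (∀ k → ∥ E k ∥₁ ≤ fromℚ ½) →
                (∀ j → v j + (v · E) j ≈ u j) → ∥ v ∥₁ ≤ 2ℝ * ∥ u ∥₁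
∥v∥₁≤2∥v+vE∥₁ v u E rows v+vE≈u = 0≤y-x⇒x≤y (begin
  0ℝ                                                ≤⟨ *-nonNeg 0≤2 (x≤y⇒0≤y-x v≤u+½v) ⟩
  2ℝ * (∥ u ∥₁ + ∥ v ∥₁ * fromℚ ½ R.- ∥ v ∥₁)       ≈⟨ solve 2 (λ v u →
      con 2ℚ :* (u :+ v :* con ½ :- v) := con 2ℚ :* u :- v) R.refl ∥ v ∥₁ ∥ u ∥₁ ⟩
  2ℝ * ∥ u ∥₁ R.- ∥ v ∥₁                            ∎)
  where
  open ≤-Reasoning
  v≤u+½v : ∥ v ∥₁ ≤ ∥ u ∥₁ + ∥ v ∥₁ * fromℚ ½
  v≤u+½v = begin
    ∥ v ∥₁                                           ≈⟨ sum-cong-≋ (λ j → ∣∣-cong (x+y≈z⇒x≈z-y (v+vE≈u j))) ⟩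
    sumℝ (λ j → ∣ u j R.- (v · E) j ∣)               ≤⟨ sum-mono-≤ (λ j → ∣z-y∣≤∣z∣+∣y∣ (u j) ((v · E) j)) ⟩
    sumℝ (λ j → ∣ u j ∣ + ∣ (v · E) j ∣)             ≈⟨ ∑-distrib-+ (λ j → ∣ u j ∣) (λ j → ∣ (v · E) j ∣) ⟩
    ∥ u ∥₁ + ∥ v · E ∥₁                              ≤⟨ +-monoʳ-≤ ∥ u ∥₁ (∥v·E∥₁≤ v E rows) ⟩
    ∥ u ∥₁ + ∥ v ∥₁ * fromℚ ½                        ∎

-- Gaussian elimination: the condition on the row sums passes to the Schur
-- complement of the first pivot.
solve-v+vE≈u : ∀ {n} (E : Matrix n n) → (∀ k → ∥ E k ∥₁ ≤ fromℚ ½) →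
               ∀ (u : Vector ℝ n) → Σ[ v ∈ Vector ℝ n ] (∀ j → v j + (v · E) j ≈ u j)
solve-v+vE≈u {zero}  E rows u = (λ ()) , λ ()
solve-v+vE≈u {suc n} E rows u = v , solves
  where
  open ≤-Reasoning
  e = E zero zero
  r : Vector ℝ n
  r j = E zero (suc j)
  -- Diagonal dominance of the first row of `1 + E`. It makes the pivot `1 + e` invertible and also
  -- gives `i * ∥ r ∥₁ ≤ 1`.
  ½+r≤1+e : fromℚ ½ + ∥ r ∥₁ ≤ 1ℝ + e
  ½+r≤1+e = 0≤y-x⇒x≤y (begin
    0ℝ ≈⟨ R.+-identityˡ 0ℝ ⟨
    0ℝ + 0ℝ ≤⟨ +-mono-≤ (x≤y⇒0≤y-x (rows zero)) (x≤y⇒0≤y-x (-x≤∣x∣ e)) ⟩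
    (fromℚ ½ R.- (∣ e ∣ + ∥ r ∥₁)) + (∣ e ∣ R.- - e) ≈⟨ solve 3 (λ a e r →
      (con ½ :- (a :+ r)) :+ (a :- :- e) := (con 1ℚ :+ e) :- (con ½ :+ r)) R.refl ∣ e ∣ e ∥ r ∥₁ ⟩
    (1ℝ + e) R.- (fromℚ ½ + ∥ r ∥₁) ∎)
  r≤1+e : ∥ r ∥₁ ≤ 1ℝ + e
  r≤1+e = begin
    ∥ r ∥₁              ≈⟨ R.+-identityˡ ∥ r ∥₁ ⟨
    0ℝ + ∥ r ∥₁         ≤⟨ +-monoˡ-≤ ∥ r ∥₁ (fromℚ-mono-≤ (ℚₚ.nonNegative⁻¹ ½)) ⟩
    fromℚ ½ + ∥ r ∥₁    ≤⟨ ½+r≤1+e ⟩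
    1ℝ + e              ∎
  ½≤1+e : fromℚ ½ ≤ 1ℝ + e
  ½≤1+e = begin
    fromℚ ½             ≈⟨ R.+-identityʳ (fromℚ ½) ⟨
    fromℚ ½ + 0ℝ        ≤⟨ +-monoʳ-≤ (fromℚ ½) (sum-nonNeg (λ j → 0≤∣x∣ (r j))) ⟩
    fromℚ ½ + ∥ r ∥₁    ≤⟨ ½+r≤1+e ⟩
    1ℝ + e              ∎
  inverse = 1/ (½ , ℚₚ.positive⁻¹ ½ , ½≤1+e)
  i = proj₁ inverse
  0≤i = proj₁ (proj₂ inverse)
  pivot*i≈1 : (1ℝ + e) * i ≈ 1ℝ
  pivot*i≈1 = proj₂ (proj₂ inverse)
  i*r≤1 : i * ∥ r ∥₁ ≤ 1ℝ
  i*r≤1 = begin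
    i * ∥ r ∥₁      ≤⟨ *-monoʳ-≤ 0≤i r≤1+e ⟩
    i * (1ℝ + e)    ≈⟨ R.*-comm i (1ℝ + e) ⟩
    (1ℝ + e) * i    ≈⟨ pivot*i≈1 ⟩
    1ℝ              ∎

  -- `1 + E′` is the Schur complement of the pivot. In each row, the deleted entry `c` pays for the
  -- correction `c * (i * r j)`, because `i * ∥ r ∥₁ ≤ 1`.
  E′ : Matrix n n
  E′ k j = E (suc k) (suc j) R.- E (suc k) zero * (i * r j)
  rows′ : ∀ k → ∥ E′ k ∥₁ ≤ fromℚ ½
  rows′ k = begin
    ∥ E′ k ∥₁
      ≤⟨ sum-mono-≤ (λ j → ∣z-y∣≤∣z∣+∣y∣ (B j) (c * (i * r j))) ⟩
    sumℝ (λ j → ∣ B j ∣ + ∣ c * (i * r j) ∣)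
      ≈⟨ ∑-distrib-+ (λ j → ∣ B j ∣) (λ j → ∣ c * (i * r j) ∣) ⟩
    ∥ B ∥₁ + sumℝ (λ j → ∣ c * (i * r j) ∣)
      ≈⟨ R.+-congˡ (sum-cong-≋ (λ j → R.trans (∣x*y∣≈∣x∣*∣y∣ c (i * r j))
           (R.*-congˡ (R.trans (∣x*y∣≈∣x∣*∣y∣ i (r j)) (R.*-congʳ (0≤x⇒∣x∣≈x 0≤i)))))) ⟩
    ∥ B ∥₁ + sumℝ (λ j → ∣ c ∣ * (i * ∣ r j ∣))
      ≈⟨ R.+-congˡ (R.trans (R.*-congˡ (*-distribˡ-sum i (λ j → ∣ r j ∣))) (*-distribˡ-sum ∣ c ∣ (λ j → i * ∣ r j ∣))) ⟨
    ∥ B ∥₁ + ∣ c ∣ * (i * ∥ r ∥₁)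
      ≤⟨ +-monoʳ-≤ ∥ B ∥₁ (*-monoʳ-≤ (0≤∣x∣ c) i*r≤1) ⟩
    ∥ B ∥₁ + ∣ c ∣ * 1ℝ
      ≈⟨ solve 2 (λ b c → b :+ c :* con 1ℚ := c :+ b) R.refl ∥ B ∥₁ ∣ c ∣ ⟩
    ∥ E (suc k) ∥₁
      ≤⟨ rows (suc k) ⟩
    fromℚ ½ ∎
    where
    c = E (suc k) zero
    B : Vector ℝ n
    B j = E (suc k) (suc j)

  -- The right-hand side is what remains of `u` after eliminating the first unknown; `v₀` is then
  -- determined by the first equation, `v₀ (1 + e) + S = u zero`.
  ih = solve-v+vE≈u E′ rows′ (λ j → u (suc j) R.- u zero * (i * r j))
  w = proj₁ ih
  S = sumℝ (λ k → w k * E (suc k) zero)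
  v₀ = (u zero R.- S) * i
  v : Vector ℝ (suc n)
  v zero    = v₀
  v (suc k) = w k

  solves : ∀ j → v j + (v · E) j ≈ u j
  solves zero = begin-equality
    v₀ + (v₀ * e + S)                  ≈⟨ solve 4 (λ u s i e → (u :- s) :* i :+ ((u :- s) :* i :* e :+ s) :=
                                            (u :- s) :* ((con 1ℚ :+ e) :* i) :+ s) R.refl (u zero) S i e ⟩
    (u zero R.- S) * ((1ℝ + e) * i) + S  ≈⟨ R.+-congʳ (R.*-congˡ pivot*i≈1) ⟩
    (u zero R.- S) * 1ℝ + S            ≈⟨ solve 2 (λ u s → (u :- s) :* con 1ℚ :+ s := u) R.refl (u zero) S ⟩
    u zero                             ∎
  solves (suc j) = begin-equality
    w j + (v₀ * r j + T)
      ≈⟨ solve 6 (λ w u s i r t → w :+ ((u :- s) :* i :* r :+ t) :=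
           w :+ (t :- s :* (i :* r)) :+ u :* (i :* r)) R.refl (w j) (u zero) S i (r j) T ⟩
    w j + (T R.- S * q) + u zero * q
      ≈⟨ R.+-congʳ (R.+-congˡ w·E′) ⟨
    w j + (w · E′) j + u zero * q
      ≈⟨ R.+-congʳ (proj₂ ih j) ⟩
    u (suc j) R.- u zero * q + u zero * q
      ≈⟨ solve 2 (λ u p → u :- p :+ p := u) R.refl (u (suc j)) (u zero * q) ⟩
    u (suc j) ∎
    where
    q = i * r j
    T = sumℝ (λ k → w k * E (suc k) (suc j))
    w·E′ : (w · E′) j ≈ T R.- S * q
    w·E′ = begin-equality
      (w · E′) j
        ≈⟨ sum-cong-≋ (λ k → solve 4 (λ w b c q → w :* (b :- c :* q) := w :* b :+ (w :* c) :* :- q)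
             R.refl (w k) (E (suc k) (suc j)) (E (suc k) zero) q) ⟩
      sumℝ (λ k → w k * E (suc k) (suc j) + w k * E (suc k) zero * - q)
        ≈⟨ ∑-distrib-+ (λ k → w k * E (suc k) (suc j)) (λ k → w k * E (suc k) zero * - q) ⟩
      T + sumℝ (λ k → w k * E (suc k) zero * - q)
        ≈⟨ R.+-congˡ (*-distribʳ-sum (- q) (λ k → w k * E (suc k) zero)) ⟨
      T + S * - q
        ≈⟨ solve 3 (λ t s q → t :+ s :* :- q := t :- s :* q) R.refl T S q ⟩
      T R.- S * q ∎

-- Unit vectors and vectors with prescribed sum.

unit : ∀ {n} → Fin n → Vector ℝ n
unit zero    zero    = 1ℝ
unit zero    (suc _) = 0ℝ
unit (suc _) zero    = 0ℝ
unit (suc k) (suc j) = unit k j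

unit-diagonal : ∀ {n} (k : Fin n) → unit k k ≡ 1ℝ
unit-diagonal zero    = ≡.refl
unit-diagonal (suc k) = unit-diagonal k

unit-nonNeg : ∀ {n} (k j : Fin n) → 0ℝ ≤ unit k j
unit-nonNeg zero    zero    = fromℚ-mono-≤ (ℚₚ.nonNegative⁻¹ 1ℚ)
unit-nonNeg zero    (suc _) = ≤-refl
unit-nonNeg (suc _) zero    = ≤-refl
unit-nonNeg (suc k) (suc j) = unit-nonNeg k j

sum-zero : ∀ {n} {f : Vector ℝ n} → (∀ i → f i ≈ 0ℝ) → sumℝ f ≈ 0ℝ
sum-zero {n} f≈0 = R.trans (sum-cong-≋ f≈0) (R.trans (sum-const n 0ℝ) (R.zeroʳ _))

sum-unit : ∀ {n} (k : Fin n) → sumℝ (unit k) ≈ 1ℝ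
sum-unit {suc n} zero    = R.trans (R.+-congˡ (sum-zero {n} λ _ → R.refl)) (R.+-identityʳ 1ℝ)
sum-unit         (suc k) = R.trans (R.+-identityˡ _) (sum-unit k)

sum-- : ∀ {n} (f g : Vector ℝ n) → sumℝ (λ i → f i R.- g i) ≈ sumℝ f R.- sumℝ g
sum-- f g = begin-equality
  sumℝ (λ i → f i R.- g i)              ≈⟨ ∑-distrib-+ f (λ i → - g i) ⟩
  sumℝ f + sumℝ (λ i → - g i)           ≈⟨ R.+-congˡ (sum-cong-≋ (λ i → solve 1 (λ x → :- x := :- con 1ℚ :* x) R.refl (g i))) ⟩
  sumℝ f + sumℝ (λ i → - 1ℝ * g i)      ≈⟨ R.+-congˡ (*-distribˡ-sum (- 1ℝ) g) ⟨
  sumℝ f + - 1ℝ * sumℝ g                ≈⟨ solve 2 (λ x y → x :+ :- con 1ℚ :* y := x :- y) R.refl (sumℝ f) (sumℝ g) ⟩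
  sumℝ f R.- sumℝ g                     ∎
  where open ≤-Reasoning

sum-scaled : ∀ {n} s (τ : Vector ℝ n) → sumℝ τ ≈ 0ℝ → sumℝ (λ k → s * τ k) ≈ 0ℝ
sum-scaled s τ Στ≈0 = R.trans (R.sym (*-distribˡ-sum s τ)) (R.trans (R.*-congˡ Στ≈0) (R.zeroʳ s))

-- The new coordinate goes to the end because `AffinelyIndependent` takes the last point as its base
-- point.
snoc : ∀ {n} → Vector ℝ n → ℝ → Vector ℝ (suc n)
snoc {zero}  t z _       = z
snoc {suc n} t z zero    = t zero
snoc {suc n} t z (suc k) = snoc (t ∘ suc) z k

snoc-inject₁ : ∀ {n} (t : Vector ℝ n) z k → snoc t z (inject₁ k) ≡ t k
snoc-inject₁ t z zero    = ≡.refl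
snoc-inject₁ t z (suc k) = snoc-inject₁ (t ∘ suc) z k

snoc-fromℕ : ∀ {n} (t : Vector ℝ n) z → snoc t z (fromℕ n) ≡ z
snoc-fromℕ {zero}  t z = ≡.refl
snoc-fromℕ {suc n} t z = snoc-fromℕ (t ∘ suc) z

-- Affine and convex combinations

module _ {v ℓ} (X : NormedSpace v ℓ) where
  open Geometry X
  private
    module ∑ᴹ = CommutativeMonoidSum +ᴹ-commutativeMonoid
    module G = AbelianGroupProperties +ᴹ-abelianGroup
    module ≈ᴹ-Reasoning = SetoidReasoning ≈ᴹ-setoid

  -1*x≈-x : ∀ x → - 1ℝ *ₗ x ≈ᴹ -ᴹ x
  -1*x≈-x x = G.inverseˡ-unique (- 1ℝ *ₗ x) x (begin
    - 1ℝ *ₗ x +ᴹ x            ≈⟨ +ᴹ-congˡ (*ₗ-identityˡ x) ⟨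
    - 1ℝ *ₗ x +ᴹ 1ℝ *ₗ x      ≈⟨ *ₗ-distribʳ x (- 1ℝ) 1ℝ ⟨
    (- 1ℝ + 1ℝ) *ₗ x          ≈⟨ *ₗ-cong (R.-‿inverseˡ 1ℝ) ≈ᴹ-refl ⟩
    0ℝ *ₗ x                   ≈⟨ *ₗ-zeroˡ x ⟩
    0ᴹ                        ∎)
    where open ≈ᴹ-Reasoning

  x+[y-x]≈y : ∀ x y → x +ᴹ (y -ᴹ x) ≈ᴹ y
  x+[y-x]≈y x y = ≈ᴹ-trans (≈ᴹ-sym (+ᴹ-assoc x y (-ᴹ x))) (G.xyx⁻¹≈y x y)

  [x+y]-x≈y : ∀ x y → (x +ᴹ y) -ᴹ x ≈ᴹ y
  [x+y]-x≈y x y = G.xyx⁻¹≈y x y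

  ‖0‖≈0 : ‖ 0ᴹ ‖ ≈ 0ℝ
  ‖0‖≈0 = begin-equality
    ‖ 0ᴹ ‖               ≈⟨ ‖‖-cong (*ₗ-zeroˡ 0ᴹ) ⟨
    ‖ 0ℝ *ₗ 0ᴹ ‖         ≈⟨ ‖‖-homo 0ℝ 0ᴹ ⟩
    ∣ 0ℝ ∣ * ‖ 0ᴹ ‖      ≈⟨ R.*-congʳ (pointwise λ _ → ≡.refl) ⟩
    0ℝ * ‖ 0ᴹ ‖          ≈⟨ R.zeroˡ ‖ 0ᴹ ‖ ⟩
    0ℝ                   ∎
    where open ≤-Reasoning

  ‖x-0‖≈‖x‖ : ∀ x → ‖ x -ᴹ 0ᴹ ‖ ≈ ‖ x ‖
  ‖x-0‖≈‖x‖ x = ‖‖-cong (≈ᴹ-trans (+ᴹ-congˡ G.ε⁻¹≈ε) (+ᴹ-identityʳ x))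

  ‖s*x‖≈s*‖x‖ : ∀ {s} → 0ℝ ≤ s → ∀ x → ‖ s *ₗ x ‖ ≈ s * ‖ x ‖
  ‖s*x‖≈s*‖x‖ {s} 0≤s x = R.trans (‖‖-homo s x) (R.*-congʳ (0≤x⇒∣x∣≈x 0≤s))

  combination-cong : ∀ {n} {t u : Vector ℝ n} {x y : Vector Carrierᴹ n} →
                     (∀ i → t i ≈ u i) → (∀ i → x i ≈ᴹ y i) → combination t x ≈ᴹ combination u y
  combination-cong t≈u x≈y = ∑ᴹ.sum-cong-≋ (λ i → *ₗ-cong (t≈u i) (x≈y i))

  combination-+ˡ : ∀ {n} (t u : Vector ℝ n) (x : Vector Carrierᴹ n) →
                   combination (λ i → t i + u i) x ≈ᴹ combination t x +ᴹ combination u x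
  combination-+ˡ t u x = ≈ᴹ-trans (∑ᴹ.sum-cong-≋ (λ i → *ₗ-distribʳ (x i) (t i) (u i)))
    (∑ᴹ.∑-distrib-+ (λ i → t i *ₗ x i) (λ i → u i *ₗ x i))

  combination-+ʳ : ∀ {n} (t : Vector ℝ n) (x y : Vector Carrierᴹ n) →
                   combination t (λ i → x i +ᴹ y i) ≈ᴹ combination t x +ᴹ combination t y
  combination-+ʳ t x y = ≈ᴹ-trans (∑ᴹ.sum-cong-≋ (λ i → *ₗ-distribˡ (t i) (x i) (y i)))
    (∑ᴹ.∑-distrib-+ (λ i → t i *ₗ x i) (λ i → t i *ₗ y i))

  combination-*ˡ : ∀ {n} s (t : Vector ℝ n) (x : Vector Carrierᴹ n) →
                   combination (λ i → s * t i) x ≈ᴹ s *ₗ combination t x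
  combination-*ˡ {zero}  s t x = ≈ᴹ-sym (*ₗ-zeroʳ s)
  combination-*ˡ {suc n} s t x = ≈ᴹ-trans
    (+ᴹ-cong (*ₗ-assoc s (t zero) (x zero)) (combination-*ˡ s (t ∘ suc) (x ∘ suc)))
    (≈ᴹ-sym (*ₗ-distribˡ s (t zero *ₗ x zero) (combination (t ∘ suc) (x ∘ suc))))

  combination--ˡ : ∀ {n} (t u : Vector ℝ n) (x : Vector Carrierᴹ n) →
                   combination (λ i → t i R.- u i) x ≈ᴹ combination t x -ᴹ combination u x
  combination--ˡ t u x = begin
    combination (λ i → t i R.- u i) x                       ≈⟨ combination-+ˡ t (λ i → - u i) x ⟩
    combination t x +ᴹ combination (λ i → - u i) x          ≈⟨ +ᴹ-congˡ (combination-cong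
      (λ i → solve 1 (λ x → :- x := :- con 1ℚ :* x) R.refl (u i)) (λ _ → ≈ᴹ-refl)) ⟩
    combination t x +ᴹ combination (λ i → - 1ℝ * u i) x     ≈⟨ +ᴹ-congˡ (combination-*ˡ (- 1ℝ) u x) ⟩
    combination t x +ᴹ - 1ℝ *ₗ combination u x              ≈⟨ +ᴹ-congˡ (-1*x≈-x (combination u x)) ⟩
    combination t x -ᴹ combination u x                      ∎
    where open ≈ᴹ-Reasoning

  combination-const : ∀ {n} (t : Vector ℝ n) x → combination t (λ _ → x) ≈ᴹ sumℝ t *ₗ x
  combination-const {zero}  t x = ≈ᴹ-sym (*ₗ-zeroˡ x)
  combination-const {suc n} t x = ≈ᴹ-trans (+ᴹ-congˡ (combination-const (t ∘ suc) x))
    (≈ᴹ-sym (*ₗ-distribʳ x (t zero) (sumℝ (t ∘ suc))))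

  combination-zero : ∀ {n} (x : Vector Carrierᴹ n) → combination (λ _ → 0ℝ) x ≈ᴹ 0ᴹ
  combination-zero {zero}  x = ≈ᴹ-refl
  combination-zero {suc n} x = ≈ᴹ-trans (+ᴹ-cong (*ₗ-zeroˡ (x zero)) (combination-zero (x ∘ suc)))
    (+ᴹ-identityˡ 0ᴹ)

  combination-unit : ∀ {n} (k : Fin n) (x : Vector Carrierᴹ n) → combination (unit k) x ≈ᴹ x k
  combination-unit zero    x = ≈ᴹ-trans (+ᴹ-cong (*ₗ-identityˡ (x zero)) (combination-zero (x ∘ suc)))
    (+ᴹ-identityʳ (x zero))
  combination-unit (suc k) x = ≈ᴹ-trans (+ᴹ-cong (*ₗ-zeroˡ (x zero)) (combination-unit k (x ∘ suc)))
    (+ᴹ-identityˡ (x (suc k)))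

  -- Serves to flatten nested combinations and to pass from coordinates over one family of points to
  -- coordinates over another.
  combination-· : ∀ {m n} (t : Vector ℝ m) (B : Matrix m n) (x : Vector Carrierᴹ n) →
                  combination (t · B) x ≈ᴹ combination t (λ k → combination (B k) x)
  combination-· {zero}  t B x = combination-zero x
  combination-· {suc m} t B x = begin
    combination (t · B) x
      ≈⟨ combination-+ˡ (λ j → t zero * B zero j) ((t ∘ suc) · (B ∘ suc)) x ⟩
    combination (λ j → t zero * B zero j) x +ᴹ combination ((t ∘ suc) · (B ∘ suc)) x
      ≈⟨ +ᴹ-cong (combination-*ˡ (t zero) (B zero) x) (combination-· (t ∘ suc) (B ∘ suc) x) ⟩
    combination t (λ k → combination (B k) x) ∎
    where open ≈ᴹ-Reasoning

  -- The base point collects the coefficient `− Σ t`, which is the last entry of `τ` because `τ`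
  -- sums to 0. Zero-sum vectors thus replace the differences and treat all vertices alike.
  combination-differences : ∀ {n} (τ : Vector ℝ (suc n)) → sumℝ τ ≈ 0ℝ → (x : Vector Carrierᴹ (suc n)) →
    combination (τ ∘ inject₁) (λ k → x (inject₁ k) -ᴹ x (fromℕ n)) ≈ᴹ combination τ x
  combination-differences {n} τ Στ≈0 x = begin
    combination t (λ k → x (inject₁ k) -ᴹ l)             ≈⟨ combination-+ʳ t (x ∘ inject₁) (λ _ → -ᴹ l) ⟩
    combination t (x ∘ inject₁) +ᴹ combination t (λ _ → -ᴹ l)
                                                          ≈⟨ +ᴹ-congˡ (combination-const t (-ᴹ l)) ⟩
    combination t (x ∘ inject₁) +ᴹ sumℝ t *ₗ (-ᴹ l)       ≈⟨ +ᴹ-congˡ (*ₗ-cong R.refl (-1*x≈-x l)) ⟨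
    combination t (x ∘ inject₁) +ᴹ sumℝ t *ₗ (- 1ℝ *ₗ l)  ≈⟨ +ᴹ-congˡ (*ₗ-assoc (sumℝ t) (- 1ℝ) l) ⟨
    combination t (x ∘ inject₁) +ᴹ (sumℝ t * - 1ℝ) *ₗ l   ≈⟨ +ᴹ-congˡ (*ₗ-cong coefficient ≈ᴹ-refl) ⟩
    combination t (x ∘ inject₁) +ᴹ τ (fromℕ n) *ₗ l       ≈⟨ ∑ᴹ.sum-init-last (λ i → τ i *ₗ x i) ⟨
    combination τ x                                       ∎
    where
    open ≈ᴹ-Reasoning
    t = τ ∘ inject₁
    l = x (fromℕ n)
    coefficient : sumℝ t * - 1ℝ ≈ τ (fromℕ n)
    coefficient = R.trans
      (solve 2 (λ s z → s :* :- con 1ℚ := z :- (s :+ z)) R.refl (sumℝ t) (τ (fromℕ n)))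
      (R.trans (R.+-congˡ (R.-‿cong (R.trans (R.sym (sum-init-last τ)) Στ≈0)))
        (solve 1 (λ z → z :- con 0ℚ := z) R.refl (τ (fromℕ n))))

  -- Barycentric coordinates.

  convex-combination∈co : ∀ {n} {x : Vector Carrierᴹ n} {y} (t : Vector ℝ n) → sumℝ t ≈ 1ℝ →
    (∀ k → 0ℝ ≤ t k) → y ≈ᴹ combination t x → y ∈ co (points x)
  convex-combination∈co {x = x} t Σt≈1 0≤t y≈ = _ , t , x , (λ k → k , ≈ᴹ-refl) , Σt≈1 , 0≤t , y≈

  -- Here `aff` is taken of the simplex and not of its vertices, so each vertex is first placed in
  -- the simplex by its unit vector.
  affine-combination∈aff : ∀ {n} {x : Vector Carrierᴹ n} {y} (t : Vector ℝ n) → sumℝ t ≈ 1ℝ →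
    y ≈ᴹ combination t x → y ∈ aff (co (points x))
  affine-combination∈aff {x = x} t Σt≈1 y≈ = _ , t , x ,
    (λ k → convex-combination∈co (unit k) (sum-unit k) (unit-nonNeg k) (≈ᴹ-sym (combination-unit k x))) ,
    Σt≈1 , y≈

  sum-·-affine : ∀ {m n} (t : Vector ℝ m) (B : Matrix m n) → sumℝ t ≈ 1ℝ → (∀ k → sumℝ (B k) ≈ 1ℝ) →
                 sumℝ (t · B) ≈ 1ℝ
  sum-·-affine t B Σt≈1 ΣB≈1 = R.trans (sum-· t B) (R.trans
    (sum-cong-≋ (λ k → R.trans (R.*-congˡ (ΣB≈1 k)) (R.*-identityʳ (t k)))) Σt≈1)

  -- The given combination may repeat or omit vertices. Multiplying its weights by a matrix of unit
  -- vectors collects them vertex by vertex.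
  co-coordinates : ∀ {n} {x : Vector Carrierᴹ n} {y} → y ∈ co (points x) →
    Σ[ t ∈ Vector ℝ n ] (sumℝ t ≈ 1ℝ × (∀ k → 0ℝ ≤ t k) × y ≈ᴹ combination t x)
  co-coordinates {n} {x} (m , t , p , p∈x , Σt≈1 , 0≤t , y≈) =
    t · B , sum-·-affine t B Σt≈1 (λ k → sum-unit (proj₁ (p∈x k))) ,
    (λ j → sum-nonNeg (λ k → *-nonNeg (0≤t k) (unit-nonNeg (proj₁ (p∈x k)) j))) ,
    ≈ᴹ-trans y≈ (≈ᴹ-trans
      (combination-cong (λ _ → R.refl) (λ k → ≈ᴹ-trans (proj₂ (p∈x k)) (≈ᴹ-sym (combination-unit (proj₁ (p∈x k)) x))))
      (≈ᴹ-sym (combination-· t B x)))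
    where
    B : Matrix m n
    B k = unit (proj₁ (p∈x k))

  aff-coordinates : ∀ {n} {x : Vector Carrierᴹ n} {y} → y ∈ aff (co (points x)) →
    Σ[ t ∈ Vector ℝ n ] (sumℝ t ≈ 1ℝ × y ≈ᴹ combination t x)
  aff-coordinates {n} {x} (m , t , p , p∈co , Σt≈1 , y≈) =
    t · B , sum-·-affine t B Σt≈1 (λ k → proj₁ (proj₂ (co-coordinates (p∈co k)))) ,
    ≈ᴹ-trans y≈ (≈ᴹ-trans
      (combination-cong (λ _ → R.refl) (λ k → proj₂ (proj₂ (proj₂ (co-coordinates (p∈co k))))))
      (≈ᴹ-sym (combination-· t B x)))
    where
    B : Matrix m n
    B k = proj₁ (co-coordinates (p∈co k))

  -- Independence is stated positively, so a vanishing combination only refutes `0ℝ < ∥ t ∥₁`;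
  -- `≯0⇒≤0` turns this into an upper bound. The last entry is `− Σ t` and vanishes as well.
  affinely-independent⇒unique : ∀ {n} {a : Vector Carrierᴹ (suc n)} → AffinelyIndependent a →
    (τ : Vector ℝ (suc n)) → sumℝ τ ≈ 0ℝ → combination τ a ≈ᴹ 0ᴹ → ∀ k → τ k ≈ 0ℝ
  affinely-independent⇒unique {n} {a} indep τ Στ≈0 τa≈0 k =
    ≤-antisym (≤-trans (x≤∣x∣ (τ k)) ∣τₖ∣≤0)
      (0≤y-x⇒x≤y (≤-trans (x≤y⇒0≤y-x (≤-trans (-x≤∣x∣ (τ k)) ∣τₖ∣≤0))
        (≤-reflexive (solve 1 (λ x → con 0ℚ :- :- x := x :- con 0ℚ) R.refl (τ k)))))
    where
    open ≤-Reasoning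
    t = τ ∘ inject₁
    z = τ (fromℕ n)
    ∥t∥≤0 : ∥ t ∥₁ ≤ 0ℝ
    ∥t∥≤0 = ≯0⇒≤0 λ 0<∥t∥ → x≮x (<-≤-trans (indep t 0<∥t∥) (≤-reflexive (R.trans
      (‖x-0‖≈‖x‖ _) (R.trans (‖‖-cong (≈ᴹ-trans (combination-differences τ Στ≈0 a) τa≈0)) ‖0‖≈0))))
    z≈-Σt : z ≈ - sumℝ t
    z≈-Σt = R.trans (solve 2 (λ s z → z := s :+ z :- s) R.refl (sumℝ t) z)
      (R.trans (R.+-congʳ (R.trans (R.sym (sum-init-last τ)) Στ≈0)) (R.+-identityˡ (- sumℝ t)))
    ∣z∣≤0 : ∣ z ∣ ≤ 0ℝ
    ∣z∣≤0 = begin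
      ∣ z ∣           ≈⟨ ∣∣-cong z≈-Σt ⟩
      ∣ - sumℝ t ∣    ≈⟨ ∣-x∣≈∣x∣ (sumℝ t) ⟩
      ∣ sumℝ t ∣      ≤⟨ ∣sum∣≤sum∣∣ t ⟩
      ∥ t ∥₁          ≤⟨ ∥t∥≤0 ⟩
      0ℝ              ∎
    ∣τₖ∣≤0 : ∣ τ k ∣ ≤ 0ℝ
    ∣τₖ∣≤0 = begin
      ∣ τ k ∣              ≤⟨ ∣v∣≤∥v∥₁ τ k ⟩
      ∥ τ ∥₁               ≈⟨ sum-init-last (λ i → ∣ τ i ∣) ⟩
      ∥ t ∥₁ + ∣ z ∣       ≤⟨ +-mono-≤ ∥t∥≤0 ∣z∣≤0 ⟩
      0ℝ + 0ℝ              ≈⟨ R.+-identityʳ 0ℝ ⟩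
      0ℝ                   ∎

  -- Appending `− Σ t` to `t` gives a zero-sum vector with the same combination and a norm that is
  -- at least as large.
  lower-bound⇒affinely-independent : ∀ {n} (x : Vector Carrierᴹ (suc n)) →
    (∀ τ → sumℝ τ ≈ 0ℝ → 0ℝ < ∥ τ ∥₁ → 0ℝ < ‖ combination τ x ‖) → AffinelyIndependent x
  lower-bound⇒affinely-independent {n} x h t 0<∥t∥ =
    <-≤-trans (h τ Στ≈0 (<-≤-trans 0<∥t∥ ∥t∥≤∥τ∥)) (≤-reflexive (R.sym (R.trans (‖x-0‖≈‖x‖ _) (‖‖-cong
      (≈ᴹ-trans (combination-cong (λ k → R.reflexive (≡.sym (snoc-inject₁ t z k))) (λ _ → ≈ᴹ-refl))
                (combination-differences τ Στ≈0 x))))))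
    where
    open ≤-Reasoning
    z = - sumℝ t
    τ = snoc t z
    Στ≈0 : sumℝ τ ≈ 0ℝ
    Στ≈0 = R.trans (sum-init-last τ) (R.trans
      (R.+-cong (sum-cong-≋ (λ k → R.reflexive (snoc-inject₁ t z k))) (R.reflexive (snoc-fromℕ t z)))
      (R.-‿inverseʳ (sumℝ t)))
    ∥t∥≤∥τ∥ : ∥ t ∥₁ ≤ ∥ τ ∥₁
    ∥t∥≤∥τ∥ = begin
      ∥ t ∥₁                                        ≈⟨ R.+-identityʳ ∥ t ∥₁ ⟨
      ∥ t ∥₁ + 0ℝ                                   ≤⟨ +-monoʳ-≤ ∥ t ∥₁ (0≤∣x∣ (τ (fromℕ n))) ⟩
      ∥ t ∥₁ + ∣ τ (fromℕ n) ∣                      ≈⟨ R.+-congʳ (sum-cong-≋ (λ k → ∣∣-cong (R.reflexive (snoc-inject₁ t z k)))) ⟨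
      ∥ τ ∘ inject₁ ∥₁ + ∣ τ (fromℕ n) ∣            ≈⟨ sum-init-last (λ i → ∣ τ i ∣) ⟨
      ∥ τ ∥₁                                        ∎

  -- Relative interior points and perturbed vertices

  -- A relative interior point in barycentric coordinates: the coordinates stay
  -- nonnegative under every displacement of norm at most g.
  record InteriorCoordinates {n} (a : Vector Carrierᴹ (suc n)) (c : Carrierᴹ) : Set ℓ where
    field
      γ      : Vector ℝ (suc n)
      Σγ≈1   : sumℝ γ ≈ 1ℝ
      0≤γ    : ∀ k → 0ℝ ≤ γ k
      c≈γa   : c ≈ᴹ combination γ a
      g      : ℚ
      g>0    : 0ℚ ℚ.< g
      inside : ∀ τ → sumℝ τ ≈ 0ℝ → ‖ combination τ a ‖ ≤ fromℚ g → ∀ k → 0ℝ ≤ γ k + τ k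

  -- The displaced point `c + Σ τₖ aₖ` lies in the ball and in the affine hull, hence in the
  -- simplex. Affine independence identifies its nonnegative coordinates `μ` with `γ + τ`.
  relint⇒interior-coordinates : ∀ {n} {a : Vector Carrierᴹ (suc n)} {c} → AffinelyIndependent a →
    c ∈ relint (co (points a)) → InteriorCoordinates a c
  relint⇒interior-coordinates {n} {a} {c} indep (c∈co , r , 0<r , ball⊆co) = record
    { γ = γ ; Σγ≈1 = Σγ≈1 ; 0≤γ = proj₁ (proj₂ (proj₂ coords)) ; c≈γa = c≈γa
    -- Halving `q ≤ r` keeps every displacement of norm at most `g` strictly inside the open ball.
    ; g = ½ ℚ.* q ; g>0 = half>0 q>0 ; inside = inside }
    where
    coords = co-coordinates c∈co
    γ = proj₁ coords
    Σγ≈1 = proj₁ (proj₂ coords)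
    c≈γa = proj₂ (proj₂ (proj₂ coords))
    bound = positive⇒rational-lower-bound 0<r
    q = proj₁ bound
    q>0 = proj₁ (proj₂ bound)
    inside : ∀ τ → sumℝ τ ≈ 0ℝ → ‖ combination τ a ‖ ≤ fromℚ (½ ℚ.* q) → ∀ k → 0ℝ ≤ γ k + τ k
    inside τ Στ≈0 τa≤g k = ≤-trans (0≤μ k) (≤-reflexive μₖ≈γₖ+τₖ)
      where
      β : Vector ℝ (suc n)
      β i = γ i + τ i
      Σβ≈1 : sumℝ β ≈ 1ℝ
      Σβ≈1 = R.trans (∑-distrib-+ γ τ) (R.trans (R.+-cong Σγ≈1 Στ≈0) (R.+-identityʳ 1ℝ))
      y = c +ᴹ combination τ a
      y≈βa : y ≈ᴹ combination β a
      y≈βa = ≈ᴹ-trans (+ᴹ-congʳ c≈γa) (≈ᴹ-sym (combination-+ˡ γ τ a))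
      ‖y-c‖<r : ‖ y -ᴹ c ‖ < r
      ‖y-c‖<r = ≤-<-trans (≤-trans (≤-reflexive (‖‖-cong ([x+y]-x≈y c (combination τ a)))) τa≤g)
        (half-below q>0 (proj₂ (proj₂ bound)))
      y-coords = co-coordinates (ball⊆co (‖y-c‖<r , affine-combination∈aff β Σβ≈1 y≈βa))
      μ = proj₁ y-coords
      0≤μ = proj₁ (proj₂ (proj₂ y-coords))
      μₖ-βₖ≈0 = affinely-independent⇒unique {a = a} indep (λ i → μ i R.- β i)
        (R.trans (sum-- μ β) (R.trans (R.+-cong (proj₁ (proj₂ y-coords)) (R.-‿cong Σβ≈1)) (R.-‿inverseʳ 1ℝ)))
        (≈ᴹ-trans (combination--ˡ μ β a)
          (≈ᴹ-trans (+ᴹ-cong (≈ᴹ-sym (proj₂ (proj₂ (proj₂ y-coords)))) (-ᴹ‿cong (≈ᴹ-sym y≈βa))) (-ᴹ‿inverseʳ y)))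
        k
      μₖ≈γₖ+τₖ : μ k ≈ γ k + τ k
      μₖ≈γₖ+τₖ = R.trans (solve 2 (λ m b → m := m :- b :+ b) R.refl (μ k) (β k))
        (R.trans (R.+-congʳ μₖ-βₖ≈0) (R.+-identityˡ (β k)))

  module InteriorBounds {n} {a : Vector Carrierᴹ (suc n)} {c} (interior : InteriorCoordinates a c) where
    open InteriorCoordinates interior
    open ≤-Reasoning

    0≤g : 0ℝ ≤ fromℚ g
    0≤g = fromℚ-nonNeg g>0

    -- Both `γ` and `γ + τ` have nonnegative entries with sum 1, so `τ k` is a difference of two
    -- numbers between 0 and 1.
    ∣τ∣≤1 : ∀ τ → sumℝ τ ≈ 0ℝ → ‖ combination τ a ‖ ≤ fromℚ g → ∀ k → ∣ τ k ∣ ≤ 1ℝ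
    ∣τ∣≤1 τ Στ≈0 τa≤g k = ∣x∣≤y
      (begin
        τ k                        ≈⟨ R.+-identityˡ (τ k) ⟨
        0ℝ + τ k                   ≤⟨ +-monoˡ-≤ (τ k) (0≤γ k) ⟩
        γ k + τ k                  ≤⟨ term≤sum (inside τ Στ≈0 τa≤g) k ⟩
        sumℝ (λ i → γ i + τ i)     ≈⟨ ∑-distrib-+ γ τ ⟩
        sumℝ γ + sumℝ τ            ≈⟨ R.+-cong Σγ≈1 Στ≈0 ⟩
        1ℝ + 0ℝ                    ≈⟨ R.+-identityʳ 1ℝ ⟩
        1ℝ                         ∎)
      (begin
        - τ k                      ≈⟨ R.+-identityˡ (- τ k) ⟨
        0ℝ + - τ k                 ≤⟨ +-monoˡ-≤ (- τ k) (inside τ Στ≈0 τa≤g k) ⟩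
        γ k + τ k R.- τ k          ≈⟨ solve 2 (λ x y → x :+ y :- y := x) R.refl (γ k) (τ k) ⟩
        γ k                        ≤⟨ term≤sum 0≤γ k ⟩
        sumℝ γ                     ≈⟨ Σγ≈1 ⟩
        1ℝ                         ∎)

    -- Rescaling a direction to norm g keeps its coordinates in [-1, 1].
    g*∣τ∣≤‖τa‖ : ∀ τ → sumℝ τ ≈ 0ℝ → ∀ k → fromℚ g * ∣ τ k ∣ ≤ ‖ combination τ a ‖
    g*∣τ∣≤‖τa‖ τ Στ≈0 k = ≤-from-≤+ε λ ε ε>0 →
      -- The norm is not known to be positive, so `ε` is added to make it invertible; the scaling
      -- factor is `s = g / d`.
      let d = ‖ combination τ a ‖ + fromℚ ε
          ε≤d = ≤-trans (≤-reflexive (R.sym (R.+-identityˡ (fromℚ ε)))) (+-monoˡ-≤ (fromℚ ε) (‖‖-nonNeg _))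
          0≤d = ≤-trans (fromℚ-nonNeg ε>0) ε≤d
          i , 0≤i , di≈1 = 1/ (ε , ε>0 , ε≤d)
          s = fromℚ g * i
          0≤s = *-nonNeg 0≤g 0≤i
          s*d≈g = begin-equality
            fromℚ g * i * d        ≈⟨ solve 3 (λ g i d → g :* i :* d := g :* (d :* i)) R.refl (fromℚ g) i d ⟩
            fromℚ g * (d * i)      ≈⟨ R.*-congˡ di≈1 ⟩
            fromℚ g * 1ℝ           ≈⟨ R.*-identityʳ (fromℚ g) ⟩
            fromℚ g                ∎
          ‖sτa‖≤g = begin
            ‖ combination (λ j → s * τ j) a ‖   ≈⟨ ‖‖-cong (combination-*ˡ s τ a) ⟩
            ‖ s *ₗ combination τ a ‖            ≈⟨ ‖s*x‖≈s*‖x‖ 0≤s (combination τ a) ⟩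
            s * ‖ combination τ a ‖             ≤⟨ *-monoʳ-≤ 0≤s (≤-trans (≤-reflexive (R.sym (R.+-identityʳ _)))
                                                     (+-monoʳ-≤ ‖ combination τ a ‖ (fromℚ-nonNeg ε>0))) ⟩
            s * d                               ≈⟨ s*d≈g ⟩
            fromℚ g                             ∎
          s*∣τ∣≤1 = begin
            s * ∣ τ k ∣       ≈⟨ R.*-congʳ (0≤x⇒∣x∣≈x 0≤s) ⟨
            ∣ s ∣ * ∣ τ k ∣   ≈⟨ ∣x*y∣≈∣x∣*∣y∣ s (τ k) ⟨
            ∣ s * τ k ∣       ≤⟨ ∣τ∣≤1 (λ j → s * τ j) (sum-scaled s τ Στ≈0) ‖sτa‖≤g k ⟩
            1ℝ                ∎
      in begin
        fromℚ g * ∣ τ k ∣     ≈⟨ R.*-congʳ s*d≈g ⟨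
        s * d * ∣ τ k ∣       ≈⟨ solve 3 (λ s d t → s :* d :* t := d :* (s :* t)) R.refl s d ∣ τ k ∣ ⟩
        d * (s * ∣ τ k ∣)     ≤⟨ *-monoʳ-≤ 0≤d s*∣τ∣≤1 ⟩
        d * 1ℝ                ≈⟨ R.*-identityʳ d ⟩
        d                     ∎

    -- Moving c away from the vertex a k within the ball costs γ k a definite amount.
    γ-bounded-below : ∃[ ρ ] (0ℚ ℚ.< ρ × (∀ k → fromℚ ρ ≤ γ k))
    γ-bounded-below = ρ , ρ>0 , λ k → *-cancelˡ-≤ 1+s>0 (begin
        fromℚ (1ℚ ℚ.+ s) * fromℚ ρ        ≈⟨ pointwise (λ _ → [1+s]ρ≡s) ⟩
        fromℚ s                           ≈⟨ R.+-identityˡ (fromℚ s) ⟨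
        0ℝ + fromℚ s                      ≤⟨ +-monoˡ-≤ (fromℚ s) (inside (τ k) (Στ≈0 k) (τa≤g k) k) ⟩
        γ k + fromℚ s * (γ k R.- unit k k) + fromℚ s
                                          ≈⟨ R.+-congʳ (R.+-congˡ (R.*-congˡ (R.+-congˡ (R.-‿cong (R.reflexive (unit-diagonal k)))))) ⟩
        γ k + fromℚ s * (γ k R.- 1ℝ) + fromℚ s
                                          ≈⟨ solve 2 (λ c s → c :+ s :* (c :- con 1ℚ) :+ s := (con 1ℚ :+ s) :* c) R.refl (γ k) (fromℚ s) ⟩
        (1ℝ + fromℚ s) * γ k              ≈⟨ R.*-congʳ (pointwise (λ _ → ≡.refl)) ⟩
        fromℚ (1ℚ ℚ.+ s) * γ k            ∎)
      where
      d : Vector ℝ (suc n)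
      d k = ‖ combination (λ j → γ j R.- unit k j) a ‖
      -- Bounding the sum bounds the distances from `c` to all vertices at once, so the single
      -- factor `s = g / B` serves every `k`.
      upper = rational-upper-bound (sumℝ d)
      B = proj₁ upper
      s-exists = divide B {{ℚ.positive (proj₁ (proj₂ upper))}} g>0
      s = proj₁ s-exists
      s>0 = proj₁ (proj₂ s-exists)
      1+s>0 : 0ℚ ℚ.< 1ℚ ℚ.+ s
      1+s>0 = ℚₚ.+-mono-< (ℚₚ.positive⁻¹ 1ℚ) s>0
      -- `ρ = s / (1 + s)` is the solution of `ρ + s (ρ − 1) = 0`.
      ρ-exists = divide (1ℚ ℚ.+ s) {{ℚ.positive 1+s>0}} s>0
      ρ = proj₁ ρ-exists
      ρ>0 = proj₁ (proj₂ ρ-exists)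
      [1+s]ρ≡s : (1ℚ ℚ.+ s) ℚ.* ρ ≡ s
      [1+s]ρ≡s = proj₂ (proj₂ ρ-exists)
      τ : ∀ k → Vector ℝ (suc n)
      τ k j = fromℚ s * (γ j R.- unit k j)
      Στ≈0 : ∀ k → sumℝ (τ k) ≈ 0ℝ
      Στ≈0 k = sum-scaled (fromℚ s) (λ j → γ j R.- unit k j) (R.trans (sum-- γ (unit k))
        (R.trans (R.+-cong Σγ≈1 (R.-‿cong (sum-unit k))) (R.-‿inverseʳ 1ℝ)))
      τa≤g : ∀ k → ‖ combination (τ k) a ‖ ≤ fromℚ g
      τa≤g k = begin
        ‖ combination (τ k) a ‖   ≈⟨ ‖‖-cong (combination-*ˡ (fromℚ s) (λ j → γ j R.- unit k j) a) ⟩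
        ‖ fromℚ s *ₗ combination (λ j → γ j R.- unit k j) a ‖ ≈⟨ ‖s*x‖≈s*‖x‖ (fromℚ-nonNeg s>0) _ ⟩
        fromℚ s * d k             ≤⟨ *-monoʳ-≤ (fromℚ-nonNeg s>0)
                                       (≤-trans (term≤sum (λ i → ‖‖-nonNeg (combination (λ j → γ j R.- unit i j) a)) k)
                                                (proj₂ (proj₂ upper))) ⟩
        fromℚ s * fromℚ B         ≈⟨ pointwise (λ _ → ≡.trans (ℚₚ.*-comm s B) (proj₂ (proj₂ s-exists))) ⟩
        fromℚ g                   ∎

    -- The bound 4θ ≤ ρ: the coordinates κ = γ − κE lose at most 2θ against γ, and a
    -- displacement inside the new ball costs at most another 2θ.
    module Perturbation (ρ : ℚ) (ρ≤γ : ∀ k → fromℚ ρ ≤ γ k) (θ ω : ℚ)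
      (θ≤½ : θ ℚ.≤ ½) (4θ≤ρ : 2ℚ ℚ.* (2ℚ ℚ.* θ) ℚ.≤ ρ)
      (ω>0 : 0ℚ ℚ.< ω) (Nω≡θ : natural (suc n) ℚ.* ω ≡ θ)
      (x : Vector Carrierᴹ (suc n)) (x∈aff : ∀ k → x k ∈ aff (co (points a)))
      (x-near-a : ∀ k → ‖ x k -ᴹ a k ‖ ≤ fromℚ g * fromℚ ω) where

      N = fromℚ (natural (suc n))

      0≤N : 0ℝ ≤ N
      0≤N = fromℚ-mono-≤ (natural-nonNeg (suc n))

      N*ω≈θ : N * fromℚ ω ≈ fromℚ θ
      N*ω≈θ = pointwise λ _ → Nω≡θ

      -- With the unit vector subtracted, row `k` holds the coordinates of the displacement
      -- `x k − a k`: it sums to 0 and is small when the displacement is.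
      E : Matrix (suc n) (suc n)
      E k j = proj₁ (aff-coordinates (x∈aff k)) j R.- unit k j

      ΣE≈0 : ∀ k → sumℝ (E k) ≈ 0ℝ
      ΣE≈0 k = R.trans (sum-- (proj₁ (aff-coordinates (x∈aff k))) (unit k)) (R.trans
        (R.+-cong (proj₁ (proj₂ (aff-coordinates (x∈aff k)))) (R.-‿cong (sum-unit k))) (R.-‿inverseʳ 1ℝ))

      Ea≈x-a : ∀ k → combination (E k) a ≈ᴹ x k -ᴹ a k
      Ea≈x-a k = ≈ᴹ-trans (combination--ˡ (proj₁ (aff-coordinates (x∈aff k))) (unit k) a)
        (+ᴹ-cong (≈ᴹ-sym (proj₂ (proj₂ (aff-coordinates (x∈aff k))))) (-ᴹ‿cong (combination-unit k a)))

      -- The bound `g*∣τ∣≤‖τa‖` for the displacement makes each entry at most `ω`, and a row has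
      -- `suc n` entries; hence the condition `N ω = θ`.
      rows≤θ : ∀ k → ∥ E k ∥₁ ≤ fromℚ θ
      rows≤θ k = begin
        ∥ E k ∥₁                            ≤⟨ sum-mono-≤ (λ j → *-cancelˡ-≤ g>0 (g∣E∣≤gω j)) ⟩
        sumℝ {suc n} (λ _ → fromℚ ω)        ≈⟨ sum-const (suc n) (fromℚ ω) ⟩
        N * fromℚ ω                         ≈⟨ N*ω≈θ ⟩
        fromℚ θ                             ∎
        where
        g∣E∣≤gω : ∀ j → fromℚ g * ∣ E k j ∣ ≤ fromℚ g * fromℚ ω
        g∣E∣≤gω j = begin
          fromℚ g * ∣ E k j ∣       ≤⟨ g*∣τ∣≤‖τa‖ (E k) (ΣE≈0 k) j ⟩
          ‖ combination (E k) a ‖   ≈⟨ ‖‖-cong (Ea≈x-a k) ⟩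
          ‖ x k -ᴹ a k ‖            ≤⟨ x-near-a k ⟩
          fromℚ g * fromℚ ω         ∎

      rows≤½ : ∀ k → ∥ E k ∥₁ ≤ fromℚ ½
      rows≤½ k = ≤-trans (rows≤θ k) (fromℚ-mono-≤ θ≤½)

      infixl 7 _·[1+E]
      _·[1+E] : Vector ℝ (suc n) → Vector ℝ (suc n)
      (t ·[1+E]) j = t j + (t · E) j

      -- Because the rows of `E` sum to 0, affine coefficients stay affine and zero-sum ones stay
      -- zero-sum when the vertices change.
      sum-·[1+E] : ∀ t → sumℝ (t ·[1+E]) ≈ sumℝ t
      sum-·[1+E] t = begin-equality
        sumℝ (t ·[1+E])                            ≈⟨ ∑-distrib-+ t (t · E) ⟩
        sumℝ t + sumℝ (t · E)                      ≈⟨ R.+-congˡ (sum-· t E) ⟩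
        sumℝ t + sumℝ (λ k → t k * sumℝ (E k))     ≈⟨ R.+-congˡ (sum-zero (λ k → R.trans (R.*-congˡ (ΣE≈0 k)) (R.zeroʳ (t k)))) ⟩
        sumℝ t + 0ℝ                                ≈⟨ R.+-identityʳ (sumℝ t) ⟩
        sumℝ t                                     ∎

      change-of-vertices : ∀ t → combination t x ≈ᴹ combination (t ·[1+E]) a
      change-of-vertices t = ≈ᴹ-trans
        (combination-cong {t = t} (λ _ → R.refl) (λ k → ≈ᴹ-trans (≈ᴹ-sym (x+[y-x]≈y (a k) (x k)))
          (+ᴹ-congˡ (≈ᴹ-sym (Ea≈x-a k)))))
        (≈ᴹ-trans (combination-+ʳ t a (λ k → combination (E k) a))
          (≈ᴹ-trans (+ᴹ-congˡ (≈ᴹ-sym (combination-· t E a))) (≈ᴹ-sym (combination-+ˡ t (t · E) a))))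

      -- Carries the independence bound from `a` over to `x`. The factor 2 comes from the lower
      -- bound on `1 + E`, and `N` from adding up the coordinatewise bounds for `σ`.
      g*∥τ∥≤2N‖τx‖ : ∀ τ → sumℝ τ ≈ 0ℝ → fromℚ g * ∥ τ ∥₁ ≤ 2ℝ * N * ‖ combination τ x ‖
      g*∥τ∥≤2N‖τx‖ τ Στ≈0 = begin
        fromℚ g * ∥ τ ∥₁
          ≤⟨ *-monoʳ-≤ 0≤g (∥v∥₁≤2∥v+vE∥₁ τ σ E rows≤½ (λ _ → R.refl)) ⟩
        fromℚ g * (2ℝ * ∥ σ ∥₁)
          ≈⟨ solve 3 (λ g t s → g :* (t :* s) := t :* (g :* s)) R.refl (fromℚ g) 2ℝ ∥ σ ∥₁ ⟩
        2ℝ * (fromℚ g * ∥ σ ∥₁)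
          ≈⟨ R.*-congˡ (*-distribˡ-sum (fromℚ g) (λ j → ∣ σ j ∣)) ⟩
        2ℝ * sumℝ (λ j → fromℚ g * ∣ σ j ∣)
          ≤⟨ *-monoʳ-≤ 0≤2 (sum-mono-≤ (g*∣τ∣≤‖τa‖ σ (R.trans (sum-·[1+E] τ) Στ≈0))) ⟩
        2ℝ * sumℝ {suc n} (λ _ → ‖ combination σ a ‖)
          ≈⟨ R.*-congˡ (sum-const (suc n) ‖ combination σ a ‖) ⟩
        2ℝ * (N * ‖ combination σ a ‖)
          ≈⟨ R.*-assoc 2ℝ N ‖ combination σ a ‖ ⟨
        2ℝ * N * ‖ combination σ a ‖
          ≈⟨ R.*-congˡ (‖‖-cong (change-of-vertices τ)) ⟨
        2ℝ * N * ‖ combination τ x ‖ ∎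
        where σ = τ ·[1+E]

      x-independent : AffinelyIndependent x
      x-independent = lower-bound⇒affinely-independent x λ τ Στ≈0 0<∥τ∥ →
        let q , q>0 , q≤∥τ∥ = positive⇒rational-lower-bound 0<∥τ∥
            2N>0 = *-pos-ℚ (ℚₚ.positive⁻¹ 2ℚ) (natural-pos n)
            -- `η = g q / 2N` is an explicit positive lower bound for the norm.
            η , η>0 , 2Nη≡gq = divide (2ℚ ℚ.* natural (suc n)) {{ℚ.positive 2N>0}} (*-pos-ℚ g>0 q>0)
        in <-≤-trans (fromℚ-pos η>0) (*-cancelˡ-≤ 2N>0 (begin
             fromℚ (2ℚ ℚ.* natural (suc n)) * fromℚ η            ≈⟨ pointwise (λ _ → 2Nη≡gq) ⟩
             fromℚ g * fromℚ q                                   ≤⟨ *-monoʳ-≤ 0≤g q≤∥τ∥ ⟩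
             fromℚ g * ∥ τ ∥₁                                    ≤⟨ g*∥τ∥≤2N‖τx‖ τ Στ≈0 ⟩
             2ℝ * N * ‖ combination τ x ‖                        ≈⟨ R.*-congʳ (pointwise (λ _ → ≡.refl)) ⟩
             fromℚ (2ℚ ℚ.* natural (suc n)) * ‖ combination τ x ‖ ∎))

      -- Solving `κ (1 + E) = γ` yields the coordinates of `c` over the moved vertices.
      solution = solve-v+vE≈u E rows≤½ γ
      κ = proj₁ solution

      Σκ≈1 : sumℝ κ ≈ 1ℝ
      Σκ≈1 = R.trans (R.sym (sum-·[1+E] κ)) (R.trans (sum-cong-≋ (proj₂ solution)) Σγ≈1)

      c≈κx : c ≈ᴹ combination κ x
      c≈κx = ≈ᴹ-trans c≈γa (≈ᴹ-sym (≈ᴹ-trans (change-of-vertices κ)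
        (combination-cong {x = a} (proj₂ solution) (λ _ → ≈ᴹ-refl))))

      2θ : ℝ
      2θ = 2ℝ * fromℚ θ

      -- The factor 2 is `2 ∥ γ ∥₁`, a bound for `∥ κ ∥₁`, since `γ` is nonnegative with sum 1.
      ∣κE∣≤2θ : ∀ k → ∣ (κ · E) k ∣ ≤ 2θ
      ∣κE∣≤2θ k = begin
        ∣ (κ · E) k ∣          ≤⟨ ∣v∣≤∥v∥₁ (κ · E) k ⟩
        ∥ κ · E ∥₁             ≤⟨ ∥v·E∥₁≤ κ E rows≤θ ⟩
        ∥ κ ∥₁ * fromℚ θ       ≤⟨ *-monoˡ-≤ 0≤θ (∥v∥₁≤2∥v+vE∥₁ κ γ E rows≤½ (proj₂ solution)) ⟩
        2ℝ * ∥ γ ∥₁ * fromℚ θ  ≈⟨ R.*-congʳ (R.*-congˡ (R.trans (sum-cong-≋ (λ j → 0≤x⇒∣x∣≈x (0≤γ j))) Σγ≈1)) ⟩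
        2ℝ * 1ℝ * fromℚ θ      ≈⟨ R.*-congʳ (R.*-identityʳ 2ℝ) ⟩
        2θ                     ∎
        where
        0≤θ : 0ℝ ≤ fromℚ θ
        0≤θ = ≤-trans (*-nonNeg 0≤N (fromℚ-nonNeg ω>0)) (≤-reflexive N*ω≈θ)

      -- With `τ = 0` this puts `c` in the new simplex; with `τ = μ − κ` it does the same for a
      -- nearby point with coordinates `μ`.
      0≤κ+τ : ∀ {τ} k → ∣ τ ∣ ≤ 2θ → 0ℝ ≤ κ k + τ
      0≤κ+τ {τ} k ∣τ∣≤2θ = begin
        0ℝ                                            ≤⟨ x≤y⇒0≤y-x (fromℚ-mono-≤ 4θ≤ρ) ⟩
        fromℚ ρ R.- fromℚ (2ℚ ℚ.* (2ℚ ℚ.* θ))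
          ≈⟨ R.+-congˡ (R.-‿cong (pointwise (λ _ → ≡.refl))) ⟩
        fromℚ ρ R.- 2ℝ * 2θ                           ≈⟨ solve 2 (λ r t →
          r :- con 2ℚ :* t := r :+ :- t :+ :- t) R.refl (fromℚ ρ) 2θ ⟩
        fromℚ ρ + - 2θ + - 2θ
          ≤⟨ +-mono-≤ (+-mono-≤ (ρ≤γ k) (neg-antimono-≤ (∣κE∣≤2θ k))) (neg-antimono-≤ ∣τ∣≤2θ) ⟩
        γ k + - ∣ (κ · E) k ∣ + - ∣ τ ∣
          ≤⟨ +-mono-≤ (+-monoʳ-≤ (γ k) (neg-antimono-≤ (x≤∣x∣ ((κ · E) k))))
               (≤-trans (neg-antimono-≤ (-x≤∣x∣ τ)) (≤-reflexive (solve 1 (λ t → :- :- t := t) R.refl τ))) ⟩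
        γ k R.- (κ · E) k + τ                         ≈⟨ R.+-congʳ (x+y≈z⇒x≈z-y (proj₂ solution k)) ⟨
        κ k + τ                                       ∎

      0≤2θ : 0ℝ ≤ 2θ
      0≤2θ = ≤-trans (0≤∣x∣ _) (∣κE∣≤2θ zero)

      c∈relint : c ∈ relint (co (points x))
      -- The radius `g ω` is chosen so that `g*∥τ∥≤2N‖τx‖` bounds the change of coordinates by
      -- `2 N ω = 2θ`.
      c∈relint = convex-combination∈co κ Σκ≈1 0≤κ c≈κx , fromℚ g * fromℚ ω , gω>0 ,
        λ (‖y-c‖<gω , y∈aff) → near⇒inside (<⇒≤ ‖y-c‖<gω) (aff-coordinates y∈aff)
        where
        gω>0 : 0ℝ < fromℚ g * fromℚ ω
        gω>0 = <-≤-trans (fromℚ-pos (*-pos-ℚ g>0 ω>0))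
          (≤-reflexive (pointwise λ _ → ≡.refl))
        0≤κ : ∀ k → 0ℝ ≤ κ k
        0≤κ k = ≤-trans (0≤κ+τ k (≤-trans (≤-reflexive (pointwise {y = 0ℝ} λ _ → ≡.refl)) 0≤2θ))
          (≤-reflexive (R.+-identityʳ (κ k)))
        near⇒inside : ∀ {y} → ‖ y -ᴹ c ‖ ≤ fromℚ g * fromℚ ω →
          Σ[ μ ∈ Vector ℝ (suc n) ] (sumℝ μ ≈ 1ℝ × y ≈ᴹ combination μ x) → y ∈ co (points x)
        near⇒inside {y} ‖y-c‖≤gω (μ , Σμ≈1 , y≈μx) = convex-combination∈co μ Σμ≈1
          (λ k → ≤-trans (0≤κ+τ k (≤-trans (∣v∣≤∥v∥₁ τ k) ∥τ∥≤2θ))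
            (≤-reflexive (solve 2 (λ k m → k :+ (m :- k) := m) R.refl (κ k) (μ k)))) y≈μx
          where
          τ : Vector ℝ (suc n)
          τ k = μ k R.- κ k
          Στ≈0 : sumℝ τ ≈ 0ℝ
          Στ≈0 = R.trans (sum-- μ κ) (R.trans (R.+-cong Σμ≈1 (R.-‿cong Σκ≈1)) (R.-‿inverseʳ 1ℝ))
          τx≈y-c : combination τ x ≈ᴹ y -ᴹ c
          τx≈y-c = ≈ᴹ-trans (combination--ˡ μ κ x) (+ᴹ-cong (≈ᴹ-sym y≈μx) (-ᴹ‿cong (≈ᴹ-sym c≈κx)))
          ∥τ∥≤2θ : ∥ τ ∥₁ ≤ 2θ
          ∥τ∥≤2θ = *-cancelˡ-≤ g>0 (begin
            fromℚ g * ∥ τ ∥₁                      ≤⟨ g*∥τ∥≤2N‖τx‖ τ Στ≈0 ⟩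
            2ℝ * N * ‖ combination τ x ‖          ≈⟨ R.*-congˡ (‖‖-cong τx≈y-c) ⟩
            2ℝ * N * ‖ y -ᴹ c ‖                   ≤⟨ *-monoʳ-≤ (*-nonNeg 0≤2 0≤N) ‖y-c‖≤gω ⟩
            2ℝ * N * (fromℚ g * fromℚ ω)          ≈⟨ solve 4 (λ t n g o → t :* n :* (g :* o) := g :* (t :* (n :* o)))
                                                       R.refl 2ℝ N (fromℚ g) (fromℚ ω) ⟩
            fromℚ g * (2ℝ * (N * fromℚ ω))        ≈⟨ R.*-congˡ (R.*-congˡ N*ω≈θ) ⟩
            fromℚ g * 2θ                          ∎)

theorem29 : ∀ {v ℓ} (X : NormedSpace v ℓ) → let open Geometry X in
    ∀ (n : ℕ) (a : Vector Carrierᴹ (suc n)) → AffinelyIndependent a →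
    ∀ (c : Carrierᴹ) → c ∈ relint (co (points a)) →
    ∃[ δ ] (0ℝ < δ ×
    (∀ (x : Vector Carrierᴹ (suc n)) →
    (∀ k → x k ∈ aff (co (points a))) →
    (∀ k → ‖ x k -ᴹ a k ‖ < δ) →
    AffinelyIndependent x × c ∈ relint (co (points x))))
theorem29 X n a indep c c-interior =
  let interior = relint⇒interior-coordinates X indep c-interior
      open InteriorCoordinates interior using (g; g>0)
      open InteriorBounds X interior
      ρ , ρ>0 , ρ≤γ = γ-bounded-below
      ¼ρ>0 = half>0 (half>0 ρ>0)
      -- The bound `½` makes `1 + E` invertible, and `ρ/4` leaves room for the two losses of `2θ`.
      -- The final `δ = g ω` spreads `θ` evenly over the `suc n` entries of a row.
      θ = ½ ℚ.⊓ (½ ℚ.* (½ ℚ.* ρ))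
      θ>0 = ⊓-pos-ℚ (ℚₚ.positive⁻¹ ½) ¼ρ>0
      ω , ω>0 , Nω≡θ = divide (natural (suc n)) {{ℚ.positive (natural-pos n)}} θ>0
  in fromℚ g * fromℚ ω ,
     <-≤-trans (fromℚ-pos (*-pos-ℚ g>0 ω>0))
       (≤-reflexive (pointwise λ _ → ≡.refl)) ,
     λ x x∈aff near →
       let open Perturbation ρ ρ≤γ θ ω (ℚₚ.p⊓q≤p ½ (½ ℚ.* (½ ℚ.* ρ))) (4θ≤ρ ρ) ω>0 Nω≡θ
              x x∈aff (λ k → <⇒≤ (near k))
       in x-independent , c∈relint
  where
  4θ≤ρ : ∀ ρ → 2ℚ ℚ.* (2ℚ ℚ.* (½ ℚ.⊓ (½ ℚ.* (½ ℚ.* ρ)))) ℚ.≤ ρ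
  4θ≤ρ ρ = ℚₚ.≤-trans
    (ℚₚ.*-monoˡ-≤-nonNeg 2ℚ (ℚₚ.*-monoˡ-≤-nonNeg 2ℚ (ℚₚ.p⊓q≤q ½ (½ ℚ.* (½ ℚ.* ρ)))))
    (ℚₚ.≤-reflexive (2*2*½*½*p≡p ρ))
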